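{- Let $g\ge 2$ be an integer and let $a_0\in\{1,\dots,g-1\}$. There exists a constant $c=c(g)>0$, depending on $g$, such that, as $x\to\infty$, $$\#\{n\le x:\ n\text{ composite},\ s(n)\text{ has no digit } a_0 \text{ in its base- }g\text{ expansion}\}\ll x\exp\left(-c\sqrt{\log x}\right),$$ where the implied constant may depend on $g$.
   Context: For a positive integer $n$, $s(n)=\sum_{d\mid n,\ d<n} d=\sigma(n)-n$ is the sum of proper divisors of $n$. The base-$g$ expansion is the usual one without leading zeros. -}

module Defs where

open import Data.Digit using (Digit; toDigits)
import Data.Fin.Properties as Fin
open import Data.Integer as ℤ using (+_; -[1+_])
import Data.Integer.Properties as ℤ
open import Data.List using (List; length; filter; upTo)
import Data.List.Membership.DecPropositional as DecMembership
open import Data.Nat as ℕ using (ℕ; zero; suc)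
open import Data.Nat.Coprimality as Coprime using (1-coprimeTo)
open import Data.Nat.Divisibility using (_∣?_)
open import Data.Nat.ListAction using (sum)
open import Data.Nat.Primality using (Composite; composite?)
import Data.Nat.Properties as ℕ
open import Data.Product using (∃; _×_; _,_; proj₁; proj₂)
open import Data.Rational as ℚ
  using (ℚ; mkℚ; 0ℚ; 1ℚ; ½; _/_; 1/_; ∣_∣; *≤*; *<*; positive; nonNegative; >-nonZero)
import Data.Rational.Properties as ℚ
open import Data.Rational.Solver using (module +-*-Solver)
open import Data.Sum using (inj₁; inj₂)
open import Relation.Binary.PropositionalEquality
open import Relation.Nullary using (¬_)
open import Relation.Nullary.Decidable using (fromWitness; ¬?; _×-dec_)
open import Relation.Unary using (Pred; Decidable)

properDivisors : ℕ → List ℕ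
properDivisors n = filter (_∣? n) (upTo n)

s : ℕ → ℕ
s n = sum (properDivisors n)

module _ (g : ℕ) (g≥2 : 2 ℕ.≤ g) where

  open DecMembership (Fin._≟_ {g}) using (_∈_; _∈?_)

  digits : ℕ → List (Digit g)
  digits n = proj₁ (toDigits g {fromWitness g≥2} n)

  CompositeMissing : Digit g → Pred ℕ _
  CompositeMissing a n = Composite n × ¬ (a ∈ digits (s n))

  compositeMissing? : (a : Digit g) → Decidable (CompositeMissing a)
  compositeMissing? a n = composite? n ×-dec ¬? (a ∈? digits (s n))

count : ∀ {p} {P : Pred ℕ p} → Decidable P → ℕ → ℕ
count P? N = length (filter P? (upTo (suc N)))

-- Opaque because unfolding normalised fractions makes conversion checking of
-- rational expressions intractable.
opaque

  ι : ℕ → ℚ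
  ι n = + n / 1

  recip : ℕ → ℚ
  recip k = + 1 / suc k

expTerm : ℚ → ℕ → ℚ
expTerm q zero    = 1ℚ
expTerm q (suc k) = (expTerm q k ℚ.* q) ℚ.* recip k

-- expSum q n = Σ_{k < n} qᵏ / k!
expSum : ℚ → ℕ → ℚ
expSum q zero    = 0ℚ
expSum q (suc n) = expSum q n ℚ.+ expTerm q n

IsCauchy : (ℕ → ℚ) → Set
IsCauchy u = ∀ ε → 0ℚ ℚ.< ε →
  ∃ λ N → ∀ m n → N ℕ.≤ m → N ℕ.≤ n → ∣ u m ℚ.- u n ∣ ℚ.≤ ε

module CauchyLemmas where

  module _ where

    open +-*-Solver

    ring1 : ∀ p q → p ℚ.- q ≡ ℚ.- (q ℚ.- p)
    ring1 = solve 2 (λ p q → p :- q := :- (q :- p)) refl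

    ring2 : ∀ p q r → p ℚ.- r ≡ (p ℚ.- q) ℚ.+ (q ℚ.- r)
    ring2 = solve 3 (λ p q r → p :- r := (p :- q) :+ (q :- r)) refl

    ring3 : ∀ a e r → a ℚ.* e ℚ.* r ≡ e ℚ.* (a ℚ.* r)
    ring3 = solve 3 (λ a e r → a :* e :* r := e :* (a :* r)) refl

    ring4 : ∀ p q → p ≡ (p ℚ.- q) ℚ.+ q
    ring4 = solve 2 (λ p q → p := (p :- q) :+ q) refl

    ring5 : ∀ p q → (ℚ.- p) ℚ.- (ℚ.- q) ≡ ℚ.- (p ℚ.- q)
    ring5 = solve 2 (λ p q → :- p :- (:- q) := :- (p :- q)) refl

    ring6 : ∀ a b c d → a ℚ.* b ℚ.- c ℚ.* d ≡ a ℚ.* (b ℚ.- d) ℚ.+ d ℚ.* (a ℚ.- c)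
    ring6 = solve 4 (λ a b c d → a :* b :- c :* d := a :* (b :- d) :+ d :* (a :- c)) refl

    ring7 : ∀ i x r → i ℚ.* (x ℚ.* r) ≡ (i ℚ.* r) ℚ.* x
    ring7 = solve 3 (λ i x r → i :* (x :* r) := (i :* r) :* x) refl

    ring8 : ∀ t d i r → (t ℚ.* d ℚ.+ d ℚ.* (i ℚ.* t)) ℚ.* r ≡ d ℚ.* t ℚ.* ((1ℚ ℚ.+ i) ℚ.* r)
    ring8 = solve 4 (λ t d i r → (t :* d :+ d :* (i :* t)) :* r := d :* t :* ((con 1ℚ :+ i) :* r)) refl

    ring9 : ∀ A x B y → (A ℚ.+ x) ℚ.- (B ℚ.+ y) ≡ (A ℚ.- B) ℚ.+ (x ℚ.- y)
    ring9 = solve 4 (λ A x B y → (A :+ x) :- (B :+ y) := (A :- B) :+ (x :- y)) refl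

    ring10 : ∀ t m r → t ℚ.* m ℚ.* r ℚ.+ t ℚ.* m ℚ.* r ≡ t ℚ.* ((m ℚ.+ m) ℚ.* r)
    ring10 = solve 3 (λ t m r → t :* m :* r :+ t :* m :* r := t :* ((m :+ m) :* r)) refl

    ring11 : ∀ A x B → (A ℚ.+ x) ℚ.- B ≡ (A ℚ.- B) ℚ.+ x
    ring11 = solve 3 (λ A x B → (A :+ x) :- B := (A :- B) :+ x) refl

    ring12 : ∀ A x B → (A ℚ.- B) ℚ.+ x ≡ (A ℚ.+ x) ℚ.- B
    ring12 = solve 3 (λ A x B → (A :- B) :+ x := (A :+ x) :- B) refl

    ring13 : ∀ e t → (e ℚ.+ t) ℚ.- e ≡ t
    ring13 = solve 2 (λ e t → (e :+ t) :- e := t) refl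

    ring14 : ∀ x a y b r → x ℚ.* a ℚ.* r ℚ.- y ℚ.* b ℚ.* r ≡ (x ℚ.* (a ℚ.- b) ℚ.+ (x ℚ.- y) ℚ.* b) ℚ.* r
    ring14 = solve 5 (λ x a y b r → x :* a :* r :- y :* b :* r := (x :* (a :- b) :+ (x :- y) :* b) :* r) refl

  opaque
    unfolding ι recip

    ι-mkℚ : ∀ n → ι n ≡ mkℚ (+ n) 0 (Coprime.sym (1-coprimeTo n))
    ι-mkℚ n = ℚ.normalize-coprime (Coprime.sym (1-coprimeTo n))

    recip-mkℚ : ∀ k → recip k ≡ mkℚ (+ 1) k (1-coprimeTo (suc k))
    recip-mkℚ k = ℚ.normalize-coprime (1-coprimeTo (suc k))

    ι-mono : ∀ {m n} → m ℕ.≤ n → ι m ℚ.≤ ι n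
    ι-mono {m} {n} m≤n rewrite ι-mkℚ m | ι-mkℚ n =
      *≤* (ℤ.*-monoʳ-≤-nonNeg (+ 1) (ℤ.+≤+ m≤n))

    ι-nonNeg : ∀ n → 0ℚ ℚ.≤ ι n
    ι-nonNeg n = ι-mono {0} {n} ℕ.z≤n

    ι-zero : ι 0 ≡ 0ℚ
    ι-zero = refl

    ι-suc : ∀ n → ι (suc n) ≡ 1ℚ ℚ.+ ι n
    ι-suc n rewrite ι-mkℚ n =
      cong (λ z → z / 1) (cong (λ z → + 1 ℤ.+ z) (sym (ℤ.*-identityʳ (+ n))))

    recip-pos : ∀ k → 0ℚ ℚ.< recip k
    recip-pos k rewrite recip-mkℚ k = *<* (ℤ.+<+ (ℕ.s≤s ℕ.z≤n))

    ι*recip : ∀ k → ι (suc k) ℚ.* recip k ≡ 1ℚ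
    ι*recip k rewrite ι-mkℚ (suc k) | recip-mkℚ k =
      ℚ.*-inverseʳ (mkℚ (+ suc k) 0 (Coprime.sym (1-coprimeTo (suc k))))

  recip-nonNeg : ∀ k → 0ℚ ℚ.≤ recip k
  recip-nonNeg k = ℚ.<⇒≤ (recip-pos k)

  *-monoʳ : ∀ {p q r} → 0ℚ ℚ.≤ r → p ℚ.≤ q → p ℚ.* r ℚ.≤ q ℚ.* r
  *-monoʳ {r = r} r≥0 = ℚ.*-monoʳ-≤-nonNeg r {{nonNegative r≥0}}

  *-monoˡ : ∀ {p q r} → 0ℚ ℚ.≤ r → p ℚ.≤ q → r ℚ.* p ℚ.≤ r ℚ.* q
  *-monoˡ {r = r} r≥0 = ℚ.*-monoˡ-≤-nonNeg r {{nonNegative r≥0}}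

  *-mono : ∀ {p p′ q q′} → 0ℚ ℚ.≤ q → 0ℚ ℚ.≤ p′ → p ℚ.≤ p′ → q ℚ.≤ q′ →
           p ℚ.* q ℚ.≤ p′ ℚ.* q′
  *-mono q≥0 p′≥0 p≤p′ q≤q′ = ℚ.≤-trans (*-monoʳ q≥0 p≤p′) (*-monoˡ p′≥0 q≤q′)

  *-nonNeg : ∀ {p q} → 0ℚ ℚ.≤ p → 0ℚ ℚ.≤ q → 0ℚ ℚ.≤ p ℚ.* q
  *-nonNeg {p} {q} p≥0 q≥0 = ℚ.≤-trans (ℚ.≤-reflexive (sym (ℚ.*-zeroˡ q))) (*-monoʳ q≥0 p≥0)

  abstract

    ½-pos : ∀ {ε} → 0ℚ ℚ.< ε → 0ℚ ℚ.< ε ℚ.* ½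
    ½-pos {ε} ε>0 = subst (ℚ._< ε ℚ.* ½) (ℚ.*-zeroˡ ½) (ℚ.*-monoˡ-<-pos ½ ε>0)

  halves : ∀ ε → ε ℚ.* ½ ℚ.+ ε ℚ.* ½ ≡ ε
  halves ε = trans (sym (ℚ.*-distribˡ-+ ε ½ ½)) (ℚ.*-identityʳ ε)

  ∣-∣-sym : ∀ p q → ∣ p ℚ.- q ∣ ≡ ∣ q ℚ.- p ∣
  ∣-∣-sym p q = trans (cong ∣_∣ (ring1 p q))
                      (ℚ.∣-p∣≡∣p∣ (q ℚ.- p))

  triangle : ∀ p q r → ∣ p ℚ.- r ∣ ℚ.≤ ∣ p ℚ.- q ∣ ℚ.+ ∣ q ℚ.- r ∣
  triangle p q r = ℚ.≤-trans
    (ℚ.≤-reflexive (cong ∣_∣ (ring2 p q r)))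
    (ℚ.∣p+q∣≤∣p∣+∣q∣ (p ℚ.- q) (q ℚ.- r))

  opaque
    unfolding ι

    bounded-by-ℕ : ∀ q → ∃ λ b → q ℚ.≤ ι b
    bounded-by-ℕ (mkℚ (+ n) d c) = n , subst (mkℚ (+ n) d c ℚ.≤_) (sym (ι-mkℚ n))
      (*≤* (ℤ.*-monoˡ-≤-nonNeg (+ n) (ℤ.+≤+ (ℕ.s≤s (ℕ.z≤n {d})))))
    bounded-by-ℕ (mkℚ -[1+ n ] d c) = 0 , *≤* ℤ.-≤+

  abstract

    archimedean : ∀ p ε → 0ℚ ℚ.< ε → ∃ λ i → ∀ n → i ℕ.≤ n → p ℚ.* recip n ℚ.≤ ε
    archimedean p ε ε>0 = b , bound
      where
      instance
        ε≢0 : ℚ.NonZero ε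
        ε≢0 = >-nonZero ε>0
      b : ℕ
      b = proj₁ (bounded-by-ℕ (p ℚ.* 1/ ε))
      bound : ∀ n → b ℕ.≤ n → p ℚ.* recip n ℚ.≤ ε
      bound n b≤n = begin
        p ℚ.* recip n                        ≡⟨ cong (ℚ._* recip n) (sym (ℚ.*-identityʳ p)) ⟩
        p ℚ.* 1ℚ ℚ.* recip n                 ≡⟨ cong (λ z → p ℚ.* z ℚ.* recip n) (sym (ℚ.*-inverseˡ ε)) ⟩
        p ℚ.* (1/ ε ℚ.* ε) ℚ.* recip n       ≡⟨ cong (ℚ._* recip n) (sym (ℚ.*-assoc p (1/ ε) ε)) ⟩
        p ℚ.* 1/ ε ℚ.* ε ℚ.* recip n         ≤⟨ *-monoʳ (recip-nonNeg n) (*-monoʳ (ℚ.<⇒≤ ε>0)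
                                                 (ℚ.≤-trans (proj₂ (bounded-by-ℕ (p ℚ.* 1/ ε)))
                                                            (ι-mono (ℕ.m≤n⇒m≤1+n b≤n)))) ⟩
        ι (suc n) ℚ.* ε ℚ.* recip n          ≡⟨ ring3 (ι (suc n)) ε (recip n) ⟩
        ε ℚ.* (ι (suc n) ℚ.* recip n)        ≡⟨ cong (ε ℚ.*_) (ι*recip n) ⟩
        ε ℚ.* 1ℚ                             ≡⟨ ℚ.*-identityʳ ε ⟩
        ε                                    ∎
        where open ℚ.≤-Reasoning

    shrink : ∀ p ε → 0ℚ ℚ.< ε → ∃ λ δ → 0ℚ ℚ.< δ × p ℚ.* δ ℚ.≤ ε
    shrink p ε ε>0 =
      let i , h = archimedean p ε ε>0
      in recip i , recip-pos i , h i ℕ.≤-refl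

  ∣-∣-shift : ∀ p q {r} → ∣ p ℚ.- q ∣ ℚ.≤ r → ∣ p ∣ ℚ.≤ r ℚ.+ ∣ q ∣
  ∣-∣-shift p q {r} h = begin
    ∣ p ∣                    ≡⟨ cong ∣_∣ (ring4 p q) ⟩
    ∣ p ℚ.- q ℚ.+ q ∣        ≤⟨ ℚ.∣p+q∣≤∣p∣+∣q∣ (p ℚ.- q) q ⟩
    ∣ p ℚ.- q ∣ ℚ.+ ∣ q ∣    ≤⟨ ℚ.+-monoˡ-≤ ∣ q ∣ h ⟩
    r ℚ.+ ∣ q ∣              ∎
    where open ℚ.≤-Reasoning

  0<1 : 0ℚ ℚ.< 1ℚ
  0<1 = *<* (ℤ.+<+ (ℕ.s≤s ℕ.z≤n))

  abstract

    cauchy-bounded : ∀ {u} → IsCauchy u → ∃ λ μ → ∃ λ N → ∀ n → N ℕ.≤ n → ∣ u n ∣ ℚ.≤ ι μ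
    cauchy-bounded {u} cu =
      let N , h  = cu 1ℚ 0<1
          μ , ub = bounded-by-ℕ (1ℚ ℚ.+ ∣ u N ∣)
      in μ , N , λ n N≤n → ℚ.≤-trans (∣-∣-shift (u n) (u N) (h n N N≤n ℕ.≤-refl)) ub

  const-cauchy : ∀ q → IsCauchy (λ _ → q)
  const-cauchy q ε ε>0 = 0 , λ _ _ _ _ →
    ℚ.≤-trans (ℚ.≤-reflexive (cong ∣_∣ (ℚ.+-inverseʳ q))) (ℚ.<⇒≤ ε>0)

  neg-cauchy : ∀ {u} → IsCauchy u → IsCauchy (λ n → ℚ.- u n)
  neg-cauchy {u} cu ε ε>0 with cu ε ε>0
  ... | N , h = N , λ m n N≤m N≤n → ℚ.≤-trans
    (ℚ.≤-reflexive (trans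
      (cong ∣_∣ (ring5 (u m) (u n)))
      (ℚ.∣-p∣≡∣p∣ (u m ℚ.- u n))))
    (h m n N≤m N≤n)

  *-cauchy : ∀ {u v} → IsCauchy u → IsCauchy v → IsCauchy (λ n → u n ℚ.* v n)
  *-cauchy {u} {v} cu cv ε ε>0
    with cauchy-bounded {u} cu | cauchy-bounded {v} cv
  ... | μ , N₁ , bu | ν , N₂ , bv with shrink (ι μ ℚ.+ ι ν) ε ε>0
  ... | δ , δ>0 , small with cu δ δ>0 | cv δ δ>0
  ... | N₃ , hu | N₄ , hv = (N₁ ℕ.⊔ N₂) ℕ.⊔ (N₃ ℕ.⊔ N₄) , λ m n p q →
    let p₁ = ℕ.≤-trans (ℕ.≤-trans (ℕ.m≤m⊔n N₁ N₂) (ℕ.m≤m⊔n _ (N₃ ℕ.⊔ N₄))) p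
        q₂ = ℕ.≤-trans (ℕ.≤-trans (ℕ.m≤n⊔m N₁ N₂) (ℕ.m≤m⊔n _ (N₃ ℕ.⊔ N₄))) q
        3≤ = ℕ.≤-trans (ℕ.m≤m⊔n N₃ N₄) (ℕ.m≤n⊔m (N₁ ℕ.⊔ N₂) _)
        4≤ = ℕ.≤-trans (ℕ.m≤n⊔m N₃ N₄) (ℕ.m≤n⊔m (N₁ ℕ.⊔ N₂) _)
    in begin
      ∣ u m ℚ.* v m ℚ.- u n ℚ.* v n ∣
        ≡⟨ cong ∣_∣ (ring6
             (u m) (v m) (u n) (v n)) ⟩
      ∣ u m ℚ.* (v m ℚ.- v n) ℚ.+ v n ℚ.* (u m ℚ.- u n) ∣
        ≤⟨ ℚ.∣p+q∣≤∣p∣+∣q∣ (u m ℚ.* (v m ℚ.- v n)) (v n ℚ.* (u m ℚ.- u n)) ⟩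
      ∣ u m ℚ.* (v m ℚ.- v n) ∣ ℚ.+ ∣ v n ℚ.* (u m ℚ.- u n) ∣
        ≡⟨ cong₂ ℚ._+_ (ℚ.∣p*q∣≡∣p∣*∣q∣ (u m) (v m ℚ.- v n)) (ℚ.∣p*q∣≡∣p∣*∣q∣ (v n) (u m ℚ.- u n)) ⟩
      ∣ u m ∣ ℚ.* ∣ v m ℚ.- v n ∣ ℚ.+ ∣ v n ∣ ℚ.* ∣ u m ℚ.- u n ∣
        ≤⟨ ℚ.+-mono-≤
             (*-mono (ℚ.0≤∣p∣ (v m ℚ.- v n)) (ι-nonNeg μ) (bu m p₁) (hv m n (ℕ.≤-trans 4≤ p) (ℕ.≤-trans 4≤ q)))
             (*-mono (ℚ.0≤∣p∣ (u m ℚ.- u n)) (ι-nonNeg ν) (bv n q₂) (hu m n (ℕ.≤-trans 3≤ p) (ℕ.≤-trans 3≤ q))) ⟩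
      ι μ ℚ.* δ ℚ.+ ι ν ℚ.* δ
        ≡⟨ sym (ℚ.*-distribʳ-+ δ (ι μ) (ι ν)) ⟩
      (ι μ ℚ.+ ι ν) ℚ.* δ
        ≤⟨ small ⟩
      ε ∎
    where open ℚ.≤-Reasoning

  module Exp (μ : ℕ) where

    open ℚ.≤-Reasoning

    M : ℚ
    M = ι μ

    M≥0 : 0ℚ ℚ.≤ M
    M≥0 = ι-nonNeg μ

    t : ℕ → ℚ
    t = expTerm M

    E : ℕ → ℚ
    E = expSum M

    t≥0 : ∀ k → 0ℚ ℚ.≤ t k
    t≥0 zero    = *≤* (ℤ.+≤+ ℕ.z≤n)
    t≥0 (suc k) = *-nonNeg (*-nonNeg (t≥0 k) M≥0) (recip-nonNeg k)

    term-bound : ∀ {a} → ∣ a ∣ ℚ.≤ M → ∀ k → ∣ expTerm a k ∣ ℚ.≤ t k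
    term-bound a≤M zero = ℚ.≤-refl
    term-bound {a} a≤M (suc k) = begin
      ∣ expTerm a k ℚ.* a ℚ.* recip k ∣
        ≡⟨ ℚ.∣p*q∣≡∣p∣*∣q∣ (expTerm a k ℚ.* a) (recip k) ⟩
      ∣ expTerm a k ℚ.* a ∣ ℚ.* ∣ recip k ∣
        ≡⟨ cong₂ ℚ._*_ (ℚ.∣p*q∣≡∣p∣*∣q∣ (expTerm a k) a) (ℚ.0≤p⇒∣p∣≡p (recip-nonNeg k)) ⟩
      ∣ expTerm a k ∣ ℚ.* ∣ a ∣ ℚ.* recip k
        ≤⟨ *-monoʳ (recip-nonNeg k) (*-mono (ℚ.0≤∣p∣ a) (t≥0 k) (term-bound a≤M k) a≤M) ⟩
      t k ℚ.* M ℚ.* recip k ∎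

    D : ℕ → ℚ
    D zero    = 0ℚ
    D (suc k) = t k

    D*M : ∀ k → D k ℚ.* M ≡ ι k ℚ.* t k
    D*M zero = trans (ℚ.*-zeroˡ M) (sym (trans (cong (ℚ._* t zero) ι-zero) (ℚ.*-zeroˡ (t zero))))
    D*M (suc k) = sym (begin-equality
      ι (suc k) ℚ.* (t k ℚ.* M ℚ.* recip k)
        ≡⟨ ring7 (ι (suc k)) (t k ℚ.* M) (recip k) ⟩
      ι (suc k) ℚ.* recip k ℚ.* (t k ℚ.* M)
        ≡⟨ cong (ℚ._* (t k ℚ.* M)) (ι*recip k) ⟩
      1ℚ ℚ.* (t k ℚ.* M)
        ≡⟨ ℚ.*-identityˡ _ ⟩
      t k ℚ.* M ∎)

    term-lipschitz : ∀ {a b} → ∣ a ∣ ℚ.≤ M → ∣ b ∣ ℚ.≤ M → ∀ k →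
      ∣ expTerm a k ℚ.- expTerm b k ∣ ℚ.≤ ∣ a ℚ.- b ∣ ℚ.* D k
    term-lipschitz {a} {b} a≤M b≤M zero = ℚ.≤-reflexive (sym (ℚ.*-zeroʳ ∣ a ℚ.- b ∣))
    term-lipschitz {a} {b} a≤M b≤M (suc k) = begin
      ∣ x ℚ.* a ℚ.* r ℚ.- y ℚ.* b ℚ.* r ∣
        ≡⟨ cong ∣_∣ (ring14 x a y b r) ⟩
      ∣ (x ℚ.* (a ℚ.- b) ℚ.+ (x ℚ.- y) ℚ.* b) ℚ.* r ∣
        ≡⟨ trans (ℚ.∣p*q∣≡∣p∣*∣q∣ (x ℚ.* (a ℚ.- b) ℚ.+ (x ℚ.- y) ℚ.* b) r)
                 (cong (∣ x ℚ.* (a ℚ.- b) ℚ.+ (x ℚ.- y) ℚ.* b ∣ ℚ.*_) (ℚ.0≤p⇒∣p∣≡p (recip-nonNeg k))) ⟩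
      ∣ x ℚ.* (a ℚ.- b) ℚ.+ (x ℚ.- y) ℚ.* b ∣ ℚ.* r
        ≤⟨ *-monoʳ (recip-nonNeg k) inner ⟩
      (t k ℚ.* d ℚ.+ d ℚ.* D k ℚ.* M) ℚ.* r
        ≡⟨ cong (λ z → (t k ℚ.* d ℚ.+ z) ℚ.* r) (trans (ℚ.*-assoc d (D k) M) (cong (d ℚ.*_) (D*M k))) ⟩
      (t k ℚ.* d ℚ.+ d ℚ.* (ι k ℚ.* t k)) ℚ.* r
        ≡⟨ ring8 (t k) d (ι k) r ⟩
      d ℚ.* t k ℚ.* ((1ℚ ℚ.+ ι k) ℚ.* r)
        ≡⟨ cong (λ z → d ℚ.* t k ℚ.* z) (trans (cong (ℚ._* r) (sym (ι-suc k))) (ι*recip k)) ⟩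
      d ℚ.* t k ℚ.* 1ℚ
        ≡⟨ ℚ.*-identityʳ _ ⟩
      d ℚ.* t k ∎
      where
      x = expTerm a k
      y = expTerm b k
      r = recip k
      d = ∣ a ℚ.- b ∣
      inner : ∣ x ℚ.* (a ℚ.- b) ℚ.+ (x ℚ.- y) ℚ.* b ∣ ℚ.≤ t k ℚ.* d ℚ.+ d ℚ.* D k ℚ.* M
      inner = begin
        ∣ x ℚ.* (a ℚ.- b) ℚ.+ (x ℚ.- y) ℚ.* b ∣
          ≤⟨ ℚ.∣p+q∣≤∣p∣+∣q∣ (x ℚ.* (a ℚ.- b)) ((x ℚ.- y) ℚ.* b) ⟩
        ∣ x ℚ.* (a ℚ.- b) ∣ ℚ.+ ∣ (x ℚ.- y) ℚ.* b ∣
          ≡⟨ cong₂ ℚ._+_ (ℚ.∣p*q∣≡∣p∣*∣q∣ x (a ℚ.- b)) (ℚ.∣p*q∣≡∣p∣*∣q∣ (x ℚ.- y) b) ⟩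
        ∣ x ∣ ℚ.* d ℚ.+ ∣ x ℚ.- y ∣ ℚ.* ∣ b ∣
          ≤⟨ ℚ.+-mono-≤ (*-monoʳ (ℚ.0≤∣p∣ (a ℚ.- b)) (term-bound a≤M k))
               (ℚ.≤-trans (*-monoʳ (ℚ.0≤∣p∣ b) (term-lipschitz a≤M b≤M k))
                          (*-monoˡ (*-nonNeg (ℚ.0≤∣p∣ (a ℚ.- b)) (D≥0 k)) b≤M)) ⟩
        t k ℚ.* d ℚ.+ d ℚ.* D k ℚ.* M ∎
        where
        D≥0 : ∀ k → 0ℚ ℚ.≤ D k
        D≥0 zero    = ℚ.≤-refl
        D≥0 (suc k) = t≥0 k

    E-suc : ∀ n → E n ℚ.≤ E (suc n)
    E-suc n = ℚ.≤-trans (ℚ.≤-reflexive (sym (ℚ.+-identityʳ (E n)))) (ℚ.+-monoʳ-≤ (E n) (t≥0 n))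

    sum-lipschitz : ∀ {a b} → ∣ a ∣ ℚ.≤ M → ∣ b ∣ ℚ.≤ M → ∀ n →
      ∣ expSum a n ℚ.- expSum b n ∣ ℚ.≤ ∣ a ℚ.- b ∣ ℚ.* E n
    sum-lipschitz {a} {b} a≤M b≤M n = ℚ.≤-trans (go n) (*-monoˡ (ℚ.0≤∣p∣ (a ℚ.- b)) (SD≤E n))
      where
      SD : ℕ → ℚ
      SD zero    = 0ℚ
      SD (suc n) = SD n ℚ.+ D n
      SD-suc : ∀ n → SD (suc n) ≡ E n
      SD-suc zero    = refl
      SD-suc (suc n) = cong (ℚ._+ t n) (SD-suc n)
      SD≤E : ∀ n → SD n ℚ.≤ E n
      SD≤E zero    = ℚ.≤-refl
      SD≤E (suc n) = ℚ.≤-trans (ℚ.≤-reflexive (SD-suc n)) (E-suc n)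
      go : ∀ n → ∣ expSum a n ℚ.- expSum b n ∣ ℚ.≤ ∣ a ℚ.- b ∣ ℚ.* SD n
      go zero = ℚ.≤-reflexive (sym (ℚ.*-zeroʳ ∣ a ℚ.- b ∣))
      go (suc n) = begin
        ∣ (A ℚ.+ x) ℚ.- (B ℚ.+ y) ∣
          ≡⟨ cong ∣_∣ (ring9 A x B y) ⟩
        ∣ (A ℚ.- B) ℚ.+ (x ℚ.- y) ∣
          ≤⟨ ℚ.∣p+q∣≤∣p∣+∣q∣ (A ℚ.- B) (x ℚ.- y) ⟩
        ∣ A ℚ.- B ∣ ℚ.+ ∣ x ℚ.- y ∣
          ≤⟨ ℚ.+-mono-≤ (go n) (term-lipschitz a≤M b≤M n) ⟩
        ∣ a ℚ.- b ∣ ℚ.* SD n ℚ.+ ∣ a ℚ.- b ∣ ℚ.* D n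
          ≡⟨ sym (ℚ.*-distribˡ-+ ∣ a ℚ.- b ∣ (SD n) (D n)) ⟩
        ∣ a ℚ.- b ∣ ℚ.* (SD n ℚ.+ D n) ∎
        where
        A = expSum a n
        B = expSum b n
        x = expTerm a n
        y = expTerm b n

    K : ℕ
    K = μ ℕ.+ μ

    ι-+ : ∀ m n → ι (m ℕ.+ n) ≡ ι m ℚ.+ ι n
    ι-+ zero    n = sym (trans (cong (ℚ._+ ι n) ι-zero) (ℚ.+-identityˡ (ι n)))
    ι-+ (suc m) n = trans (ι-suc (m ℕ.+ n)) (trans (cong (1ℚ ℚ.+_) (ι-+ m n))
      (trans (sym (ℚ.+-assoc 1ℚ (ι m) (ι n))) (cong (ℚ._+ ι n) (sym (ι-suc m)))))

    term-halves : ∀ k → K ℕ.≤ k → t (suc k) ℚ.+ t (suc k) ℚ.≤ t k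
    term-halves k K≤k = begin
      t k ℚ.* M ℚ.* recip k ℚ.+ t k ℚ.* M ℚ.* recip k
        ≡⟨ ring10 (t k) M (recip k) ⟩
      t k ℚ.* ((M ℚ.+ M) ℚ.* recip k)
        ≡⟨ cong (λ z → t k ℚ.* (z ℚ.* recip k)) (sym (ι-+ μ μ)) ⟩
      t k ℚ.* (ι K ℚ.* recip k)
        ≤⟨ *-monoˡ (t≥0 k) (*-monoʳ (recip-nonNeg k) (ι-mono (ℕ.m≤n⇒m≤1+n K≤k))) ⟩
      t k ℚ.* (ι (suc k) ℚ.* recip k)
        ≡⟨ cong (t k ℚ.*_) (ι*recip k) ⟩
      t k ℚ.* 1ℚ
        ≡⟨ ℚ.*-identityʳ (t k) ⟩
      t k ∎

    term-antitone : ∀ j → t (j ℕ.+ K) ℚ.≤ t K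
    term-antitone zero    = ℚ.≤-refl
    term-antitone (suc j) = begin
      t (suc (j ℕ.+ K))                              ≡⟨ sym (ℚ.+-identityʳ _) ⟩
      t (suc (j ℕ.+ K)) ℚ.+ 0ℚ                       ≤⟨ ℚ.+-monoʳ-≤ (t (suc (j ℕ.+ K))) (t≥0 (suc (j ℕ.+ K))) ⟩
      t (suc (j ℕ.+ K)) ℚ.+ t (suc (j ℕ.+ K))        ≤⟨ term-halves (j ℕ.+ K) (ℕ.m≤n+m K j) ⟩
      t (j ℕ.+ K)                                    ≤⟨ term-antitone j ⟩
      t K                                            ∎

    potential : ℕ → ℚ
    potential n = E n ℚ.+ (t n ℚ.+ t n)

    potential-antitone : ∀ {n} → K ℕ.≤ n → ∀ j → potential (j ℕ.+ n) ℚ.≤ potential n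
    potential-antitone         K≤n zero    = ℚ.≤-refl
    potential-antitone {n} K≤n (suc j) = begin
      (E k ℚ.+ t k) ℚ.+ (t (suc k) ℚ.+ t (suc k))   ≤⟨ ℚ.+-monoʳ-≤ (E k ℚ.+ t k)
                                                        (term-halves k (ℕ.≤-trans K≤n (ℕ.m≤n+m n j))) ⟩
      (E k ℚ.+ t k) ℚ.+ t k                         ≡⟨ ℚ.+-assoc (E k) (t k) (t k) ⟩
      potential k                                   ≤⟨ potential-antitone K≤n j ⟩
      potential n                                   ∎
      where k = j ℕ.+ n

    E≤potential : ∀ n → E n ℚ.≤ potential n
    E≤potential n = ℚ.≤-trans (ℚ.≤-reflexive (sym (ℚ.+-identityʳ (E n))))
      (ℚ.+-monoʳ-≤ (E n) (ℚ.+-mono-≤ (t≥0 n) (t≥0 n)))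

    bound : ∀ n → K ℕ.≤ n → E n ℚ.≤ potential K
    bound n K≤n = ℚ.≤-trans (E≤potential n)
      (subst (λ z → potential z ℚ.≤ potential K) (ℕ.m∸n+n≡m K≤n) (potential-antitone ℕ.≤-refl (n ℕ.∸ K)))

    tail≤ : ∀ {a} → ∣ a ∣ ℚ.≤ M → ∀ n j → ∣ expSum a (j ℕ.+ n) ℚ.- expSum a n ∣ ℚ.≤ E (j ℕ.+ n) ℚ.- E n
    tail≤ {a} a≤M n zero = ℚ.≤-reflexive (trans
      (cong ∣_∣ (ℚ.+-inverseʳ (expSum a n))) (sym (ℚ.+-inverseʳ (E n))))
    tail≤ {a} a≤M n (suc j) = begin
      ∣ (A ℚ.+ x) ℚ.- expSum a n ∣
        ≡⟨ cong ∣_∣ (ring11 A x (expSum a n)) ⟩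
      ∣ (A ℚ.- expSum a n) ℚ.+ x ∣
        ≤⟨ ℚ.∣p+q∣≤∣p∣+∣q∣ (A ℚ.- expSum a n) x ⟩
      ∣ A ℚ.- expSum a n ∣ ℚ.+ ∣ x ∣
        ≤⟨ ℚ.+-mono-≤ (tail≤ a≤M n j) (term-bound a≤M (j ℕ.+ n)) ⟩
      (E (j ℕ.+ n) ℚ.- E n) ℚ.+ t (j ℕ.+ n)
        ≡⟨ ring12 (E (j ℕ.+ n)) (t (j ℕ.+ n)) (E n) ⟩
      E (suc j ℕ.+ n) ℚ.- E n ∎
      where
      A = expSum a (j ℕ.+ n)
      x = expTerm a (j ℕ.+ n)

    tail : ∀ {a} → ∣ a ∣ ℚ.≤ M → ∀ {m n} → K ℕ.≤ n → n ℕ.≤ m →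
      ∣ expSum a m ℚ.- expSum a n ∣ ℚ.≤ t n ℚ.+ t n
    tail {a} a≤M {m} {n} K≤n n≤m =
      subst (λ z → ∣ expSum a z ℚ.- expSum a n ∣ ℚ.≤ t n ℚ.+ t n) (ℕ.m∸n+n≡m n≤m) (begin
        ∣ expSum a (j ℕ.+ n) ℚ.- expSum a n ∣   ≤⟨ tail≤ a≤M n j ⟩
        E (j ℕ.+ n) ℚ.- E n                     ≤⟨ ℚ.+-monoˡ-≤ (ℚ.- E n)
                                                    (ℚ.≤-trans (E≤potential (j ℕ.+ n)) (potential-antitone K≤n j)) ⟩
        potential n ℚ.- E n                     ≡⟨ ring13 (E n) (t n ℚ.+ t n) ⟩
        t n ℚ.+ t n                             ∎)
      where j = m ℕ.∸ n

    term-small : ∀ ε → 0ℚ ℚ.< ε → ∃ λ N → K ℕ.≤ N × (∀ n → N ℕ.≤ n → t n ℚ.+ t n ℚ.≤ ε)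
    term-small ε ε>0 with archimedean (t K ℚ.* M ℚ.+ t K ℚ.* M) ε ε>0
    ... | i , h = suc (i ℕ.+ K) , ℕ.m≤n⇒m≤1+n (ℕ.m≤n+m K i) , λ { (suc n) (ℕ.s≤s i+K≤n) →
      let K≤n = ℕ.≤-trans (ℕ.m≤n+m K i) i+K≤n
          tn≤ = *-monoʳ M≥0 (subst (λ z → t z ℚ.≤ t K) (ℕ.m∸n+n≡m K≤n) (term-antitone (n ℕ.∸ K)))
      in begin
        t n ℚ.* M ℚ.* recip n ℚ.+ t n ℚ.* M ℚ.* recip n
          ≡⟨ sym (ℚ.*-distribʳ-+ (recip n) (t n ℚ.* M) (t n ℚ.* M)) ⟩
        (t n ℚ.* M ℚ.+ t n ℚ.* M) ℚ.* recip n
          ≤⟨ *-monoʳ (recip-nonNeg n) (ℚ.+-mono-≤ tn≤ tn≤) ⟩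
        (t K ℚ.* M ℚ.+ t K ℚ.* M) ℚ.* recip n
          ≤⟨ h n (ℕ.≤-trans (ℕ.m≤m+n i K) i+K≤n) ⟩
        ε ∎ }

  exp-cauchy : ∀ {u} → IsCauchy u → IsCauchy (λ n → expSum (u n) n)
  exp-cauchy {u} cu ε ε>0 with cauchy-bounded {u} cu
  ... | μ , N₁ , bu
    with Exp.term-small μ (ε ℚ.* ½) (½-pos ε>0) | shrink (Exp.potential μ (Exp.K μ)) (ε ℚ.* ½) (½-pos ε>0)
  ... | N₂ , K≤N₂ , small | δ , δ>0 , Bδ≤ with cu δ δ>0
  ... | N₃ , hu = N , main
    where
    open Exp μ
    open ℚ.≤-Reasoning
    N = N₁ ℕ.⊔ (N₂ ℕ.⊔ N₃)
    N₁≤N = ℕ.m≤m⊔n N₁ (N₂ ℕ.⊔ N₃)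
    N₂≤N = ℕ.≤-trans (ℕ.m≤m⊔n N₂ N₃) (ℕ.m≤n⊔m N₁ (N₂ ℕ.⊔ N₃))
    N₃≤N = ℕ.≤-trans (ℕ.m≤n⊔m N₂ N₃) (ℕ.m≤n⊔m N₁ (N₂ ℕ.⊔ N₃))

    ordered : ∀ {m n} → N ℕ.≤ n → n ℕ.≤ m → ∣ expSum (u m) m ℚ.- expSum (u n) n ∣ ℚ.≤ ε
    ordered {m} {n} N≤n n≤m = begin
      ∣ expSum (u m) m ℚ.- expSum (u n) n ∣
        ≤⟨ triangle (expSum (u m) m) (expSum (u m) n) (expSum (u n) n) ⟩
      ∣ expSum (u m) m ℚ.- expSum (u m) n ∣ ℚ.+ ∣ expSum (u m) n ℚ.- expSum (u n) n ∣
        ≤⟨ ℚ.+-mono-≤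
             (ℚ.≤-trans (tail um≤M K≤n n≤m) (small n (ℕ.≤-trans N₂≤N N≤n)))
             (ℚ.≤-trans (sum-lipschitz um≤M un≤M n) (begin
               ∣ u m ℚ.- u n ∣ ℚ.* E n   ≤⟨ *-mono E≥0 (ℚ.<⇒≤ δ>0)
                                             (hu m n (ℕ.≤-trans N₃≤N N≤m) (ℕ.≤-trans N₃≤N N≤n))
                                             (bound n K≤n) ⟩
               δ ℚ.* potential K         ≡⟨ ℚ.*-comm δ (potential K) ⟩
               potential K ℚ.* δ         ≤⟨ Bδ≤ ⟩
               ε ℚ.* ½                   ∎)) ⟩
      ε ℚ.* ½ ℚ.+ ε ℚ.* ½
        ≡⟨ halves ε ⟩
      ε ∎
      where
      N≤m  = ℕ.≤-trans N≤n n≤m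
      K≤n  = ℕ.≤-trans (ℕ.≤-trans K≤N₂ N₂≤N) N≤n
      um≤M = bu m (ℕ.≤-trans N₁≤N N≤m)
      un≤M = bu n (ℕ.≤-trans N₁≤N N≤n)
      E-nonNeg : ∀ n → 0ℚ ℚ.≤ E n
      E-nonNeg zero    = ℚ.≤-refl
      E-nonNeg (suc n) = ℚ.≤-trans (E-nonNeg n) (E-suc n)
      E≥0  = E-nonNeg n

    main : ∀ m n → N ℕ.≤ m → N ℕ.≤ n → ∣ expSum (u m) m ℚ.- expSum (u n) n ∣ ℚ.≤ ε
    main m n N≤m N≤n with ℕ.≤-total n m
    ... | inj₁ n≤m = ordered N≤n n≤m
    ... | inj₂ m≤n =
      ℚ.≤-trans (ℚ.≤-reflexive (∣-∣-sym (expSum (u m) m) (expSum (u n) n))) (ordered N≤m m≤n)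

open CauchyLemmas using (const-cauchy; neg-cauchy; *-cauchy; exp-cauchy)

-- A real number is a Cauchy sequence of rationals (the modulus is contained in
-- the proof of IsCauchy); equality of reals is _≈_ below, not _≡_.
record ℝ : Set where
  constructor mkℝ
  field
    seq    : ℕ → ℚ
    cauchy : IsCauchy seq

open ℝ public

infix  4 _≤ᴿ_ _<ᴿ_ _≈_
infixl 7 _*ᴿ_
infix  8 -ᴿ_

_≤ᴿ_ : ℝ → ℝ → Set
x ≤ᴿ y = ∀ ε → 0ℚ ℚ.< ε → ∃ λ N → ∀ n → N ℕ.≤ n → seq x n ℚ.≤ seq y n ℚ.+ ε

_<ᴿ_ : ℝ → ℝ → Set
x <ᴿ y = ∃ λ ε → 0ℚ ℚ.< ε × ∃ λ N → ∀ n → N ℕ.≤ n → seq x n ℚ.+ ε ℚ.≤ seq y n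

_≈_ : ℝ → ℝ → Set
x ≈ y = x ≤ᴿ y × y ≤ᴿ x

fromℚ : ℚ → ℝ
fromℚ q = mkℝ (λ _ → q) (const-cauchy q)

fromℕ : ℕ → ℝ
fromℕ n = fromℚ (ι n)

0ᴿ : ℝ
0ᴿ = fromℚ 0ℚ

-ᴿ_ : ℝ → ℝ
-ᴿ x = mkℝ (λ n → ℚ.- seq x n) (neg-cauchy {seq x} (cauchy x))

_*ᴿ_ : ℝ → ℝ → ℝ
x *ᴿ y = mkℝ (λ n → seq x n ℚ.* seq y n) (*-cauchy {seq x} {seq y} (cauchy x) (cauchy y))

-- The diagonal of the partial sums of the exponential series: these converge
-- locally uniformly, so the n-th partial sum at the n-th approximation of x
-- tends to Σ xᵏ / k!.
exp : ℝ → ℝ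
exp x = mkℝ (λ n → expSum (seq x n) n) (exp-cauchy {seq x} (cauchy x))

-- log, the square root and the floor are given by their graphs: y = log x is
-- the solution of exp y = x, and y = √x the non-negative solution of y² = x.

_IsLogOf_ : ℝ → ℝ → Set
y IsLogOf x = exp y ≈ x

_IsSqrtOf_ : ℝ → ℝ → Set
y IsSqrtOf x = 0ᴿ ≤ᴿ y × y *ᴿ y ≈ x

_IsFloorOf_ : ℕ → ℝ → Set
N IsFloorOf x = fromℕ N ≤ᴿ x × x <ᴿ fromℕ (suc N)

{-# OPTIONS --safe #-}
-- Write a composite n ≤ N as m p with p > Y = g^k prime, where k is of order
-- √log N.  The exceptions, and the n divisible by the square of such a prime,
-- are few: Rankin's method bounds the Y-smooth n, even with all integers up to
-- Y in place of the primes.  If p does not divide m > 1, then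
-- s(n) = s(m) p + σ(m).  For fixed m, drop the primality of p: if g^j is
-- comparable with s(m), then for t ≤ N/m the quotients of s(m) t + σ(m) by g^j
-- run through an interval with bounded multiplicity, whatever the common
-- factors of s(m) and g are.  So a digit is avoided by a proportion
-- O((1 - 1/g)^k) of the t, and summing over m costs only a logarithm.
module Submission where

open import Defs
open import Data.Digit using (Digit)
open import Data.Fin using (toℕ)
open import Data.Product using (∃; Σ-syntax; _×_; _,_; proj₁; proj₂)
open import Data.Sum using (_⊎_; inj₁; inj₂)
open import Relation.Binary.PropositionalEquality hiding ([_]; J)
open import Relation.Nullary using (¬_; yes; no; contradiction)

-- The shape of the bound is decided by the smooth numbers. Rankin's method saves (3/2)^r on the
-- `Y`-smooth n ≥ Y^r, and this has to beat the factor Y^2 = g^(2k) lost by its crude form. So r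
-- must be a large multiple `B` * k of k, and Y^r = g^(B k^2) ≤ N admits k only up to the order of
-- √log N. Every case then saves (1 - 1/g)^k up to a logarithm, which is of order k^2 and is paid
-- for by weakening 1 - 1/g to 1 - 1/(2 g^2). On the analytic side log x and √log x are known only
-- through exp y ≈ x and y^2 ≈ log x, and inequalities between reals hold at stage n only up to an
-- error. Two one-sided facts about partial sums suffice. A single term of the series gives exp y ≥
-- y^E / E!, which bounds log x, hence √log x by a multiple of k, from above. An approximate form of
-- exp a * exp b ≤ exp (a + b), uniform on bounded sets, raises a lower bound near 0 to ρ^k ≤ exp (-
-- c √log x).

module Arithmetic where

  open import Data.Digit using (fromDigits; toDigits)
  open import Data.Empty using (⊥-elim)
  import Data.Fin.Properties as Fin
  open import Data.List using (List; []; _∷_; _++_; length; map; upTo)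
  open import Data.List.Membership.Propositional using (_∈_; _∉_)
  open import Data.List.Membership.Propositional.Properties
  open import Data.List.Membership.Propositional.Properties.WithK using (unique∧set⇒bag)
  open import Data.List.Properties using (length-map; length-++; length-upTo; filter-notAll)
  open import Data.List.Relation.Binary.BagAndSetEquality using (∼bag⇒↭)
  import Data.List.Relation.Unary.All as All
  open import Data.List.Relation.Unary.All using (_∷_)
  open import Data.List.Relation.Unary.AllPairs using ([]; _∷_)
  import Data.List.Relation.Unary.Any as Any
  open import Data.List.Relation.Unary.Any using (here; there)
  open import Data.List.Relation.Unary.Unique.Propositional using (Unique)
  import Data.List.Relation.Unary.Unique.Propositional.Properties as Unique
  open import Data.Nat
  open import Data.Nat.DivMod
  open import Data.Nat.Divisibility
  open import Data.Nat.ListAction using (sum; product)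
  open import Data.Nat.ListAction.Properties using (sum-++; sum-↭)
  open import Data.Nat.Primality
  open import Data.Nat.Primality.Factorisation using (factorise)
  open import Data.Nat.Properties
  open import Data.Nat.Tactic.RingSolver using (solve-∀)
  open import Function.Bundles using (mk⇔)
  open import Relation.Binary.Definitions using (tri<; tri≈; tri>)
  open import Relation.Nullary.Decidable using (¬?; _×-dec_; fromWitness)
  import Relation.Unary as U

  -- Sparse sets, union bounds and finite sums

  -- W · #P ≤ d.  The cover is a list with possible repetitions, so no
  -- decidability of P is needed for union bounds.
  record Sparse (W d : ℕ) (P : ℕ → Set) : Set where
    constructor sparse
    field
      elems  : List ℕ
      size   : length elems * W ≤ d
      covers : ∀ {n} → P n → n ∈ elems

  private variable
    W d e : ℕ
    P Q : ℕ → Set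

  sparse-⊆ : (∀ {n} → Q n → P n) → Sparse W d P → Sparse W d Q
  sparse-⊆ Q⊆P (sparse xs l c) = sparse xs l (λ q → c (Q⊆P q))

  sparse-≤ : d ≤ e → Sparse W d P → Sparse W e P
  sparse-≤ d≤e (sparse xs l c) = sparse xs (≤-trans l d≤e) c

  sparse-∅ : (∀ {n} → ¬ P n) → Sparse W 0 P
  sparse-∅ ¬P = sparse [] z≤n (λ p → ⊥-elim (¬P p))

  sparse-∪ : Sparse W d P → Sparse W e Q → Sparse W (d + e) (λ n → P n ⊎ Q n)
  sparse-∪ {W} {d} {P} {e} {Q} (sparse xs l c) (sparse ys l′ c′) = sparse (xs ++ ys) len cov
    where
    len : length (xs ++ ys) * W ≤ d + e
    len = begin
      length (xs ++ ys) * W          ≡⟨ cong (_* W) (length-++ xs) ⟩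
      (length xs + length ys) * W    ≡⟨ *-distribʳ-+ W (length xs) (length ys) ⟩
      length xs * W + length ys * W  ≤⟨ +-mono-≤ l l′ ⟩
      d + e                          ∎
      where open ≤-Reasoning
    cov : ∀ {n} → P n ⊎ Q n → n ∈ xs ++ ys
    cov (inj₁ p) = ∈-++⁺ˡ (c p)
    cov (inj₂ q) = ∈-++⁺ʳ xs (c′ q)

  sparse-map : (f : ℕ → ℕ) → Sparse W d P → Sparse W d (λ n → ∃ λ m → P m × n ≡ f m)
  sparse-map {W} {d} f (sparse xs l c) =
    sparse (map f xs) (subst (λ z → z * W ≤ d) (sym (length-map f xs)) l)
      (λ { (m , p , refl) → ∈-map⁺ f (c p) })

  sparse-interval : ∀ a h → Sparse 1 h (λ n → a ≤ n × n < a + h)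
  sparse-interval a h = sparse (map (a +_) (upTo h))
    (≤-reflexive (trans (*-identityʳ _) (trans (length-map (a +_) (upTo h)) (length-upTo h))))
    (λ { {n} (a≤n , n<a+h) → subst (_∈ map (a +_) (upTo h)) (m+[n∸m]≡n a≤n)
           (∈-map⁺ (a +_) (∈-upTo⁺ (subst (n ∸ a <_) (m+n∸m≡n a h) (∸-monoˡ-< n<a+h a≤n)))) })

  -- Comparison of the fractions d / W and d′ / W′. It brings bounds found with different weights,
  -- such as 3^r and g^k, to a common one.
  sparse-rescale : ∀ {W′ d′} → .{{NonZero W}} → d * W′ ≤ d′ * W → Sparse W d P → Sparse W′ d′ P
  sparse-rescale {W} {d} {W′ = W′} {d′} dW′≤d′W (sparse xs l c) = sparse xs (*-cancelʳ-≤ _ _ W (begin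
    length xs * W′ * W  ≡⟨ reorder (length xs) W′ W ⟩
    length xs * W * W′  ≤⟨ *-monoˡ-≤ W′ l ⟩
    d * W′              ≤⟨ dW′≤d′W ⟩
    d′ * W              ∎)) c
    where
    open ≤-Reasoning
    reorder : ∀ x y z → x * y * z ≡ x * z * y
    reorder = solve-∀

  ∑ : (ℕ → ℕ) → ℕ → ℕ
  ∑ f zero    = 0
  ∑ f (suc n) = ∑ f n + f n

  ∑-mono : ∀ {f f′ : ℕ → ℕ} n → (∀ i → f i ≤ f′ i) → ∑ f n ≤ ∑ f′ n
  ∑-mono zero    f≤f′ = z≤n
  ∑-mono (suc n) f≤f′ = +-mono-≤ (∑-mono n f≤f′) (f≤f′ n)

  ∑-const : ∀ c n → ∑ (λ _ → c) n ≡ n * c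
  ∑-const c zero    = refl
  ∑-const c (suc n) = trans (cong (_+ c) (∑-const c n)) (+-comm (n * c) c)

  ∑-*ˡ : ∀ c f n → ∑ (λ i → c * f i) n ≡ c * ∑ f n
  ∑-*ˡ c f zero    = sym (*-zeroʳ c)
  ∑-*ˡ c f (suc n) = trans (cong (_+ c * f n) (∑-*ˡ c f n)) (sym (*-distribˡ-+ c (∑ f n) (f n)))

  ∑-+ : ∀ f m n → ∑ f (m + n) ≡ ∑ f m + ∑ (λ i → f (m + i)) n
  ∑-+ f m zero    = trans (cong (∑ f) (+-identityʳ m)) (sym (+-identityʳ _))
  ∑-+ f m (suc n) = trans (cong (∑ f) (+-suc m n))
    (trans (cong (_+ f (m + n)) (∑-+ f m n)) (+-assoc (∑ f m) _ _))

  ∑-monoʳ : ∀ f {m n} → m ≤ n → ∑ f m ≤ ∑ f n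
  ∑-monoʳ f {m} {n} m≤n = begin
    ∑ f m                                  ≤⟨ m≤m+n _ _ ⟩
    ∑ f m + ∑ (λ i → f (m + i)) (n ∸ m)   ≡⟨ ∑-+ f m (n ∸ m) ⟨
    ∑ f (m + (n ∸ m))                      ≡⟨ cong (∑ f) (m+[n∸m]≡n m≤n) ⟩
    ∑ f n                                  ∎
    where open ≤-Reasoning

  sparse-⋃ : ∀ {R : ℕ → ℕ → Set} {f : ℕ → ℕ} → (∀ i → Sparse W (f i) (R i)) →
    ∀ M → Sparse W (∑ f M) (λ n → ∃ λ i → i < M × R i n)
  sparse-⋃ S zero    = sparse-∅ (λ { (_ , () , _) })
  sparse-⋃ {R = R} S (suc M) = sparse-⊆ split (sparse-∪ (sparse-⋃ S M) (S M))
    where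
    split : ∀ {n} → (∃ λ i → i < suc M × R i n) → (∃ λ i → i < M × R i n) ⊎ R M n
    split {n} (i , s≤s i≤M , r) with m≤n⇒m<n∨m≡n i≤M
    ... | inj₁ i<M  = inj₁ (i , i<M , r)
    ... | inj₂ refl = inj₂ r

  -- Deleting all occurrences of the head of `xs` from `ys` shortens `ys` by at least one and keeps
  -- the inclusion of the tail, because the head does not recur there.
  unique-⊆⇒length-≤ : ∀ {xs ys : List ℕ} → Unique xs → (∀ {x} → x ∈ xs → x ∈ ys) → length xs ≤ length ys
  unique-⊆⇒length-≤ {[]}     []         xs⊆ys = z≤n
  unique-⊆⇒length-≤ {x ∷ xs} {ys} (x∉ ∷ u) xs⊆ys = ≤-<-trans
    (unique-⊆⇒length-≤ u (λ {y} y∈ → ∈-filter⁺ ≢x? (xs⊆ys (there y∈)) (λ y≡x → All.lookup x∉ y∈ (sym y≡x))))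
    (filter-notAll ≢x? ys (Any.map (λ x≡y y≢x → y≢x (sym x≡y)) (xs⊆ys (here refl))))
    where
    ≢x? : U.Decidable (_≢ x)
    ≢x? y = ¬? (y ≟ x)

  sparse⇒count : (P? : U.Decidable P) → ∀ N → Sparse W d (λ n → n ≤ N × P n) → count P? N * W ≤ d
  sparse⇒count {W = W} P? N (sparse xs l c) = ≤-trans
    (*-monoˡ-≤ W (unique-⊆⇒length-≤ (Unique.filter⁺ P? (Unique.upTo⁺ (suc N)))
      (λ n∈ → let n∈upTo , Pn = ∈-filter⁻ P? n∈ in c (s≤s⁻¹ (∈-upTo⁻ n∈upTo) , Pn)))) l

  -- Dyadic blocks: the terms with 2^ℓ ≤ m < 2^(ℓ+1) contribute at most N.
  ∑-harmonic : ∀ N ℓ → N < 2 ^ ℓ → ∑ (λ i → N / suc i) N ≤ ℓ * N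
  ∑-harmonic N ℓ N<2^ℓ = ≤-trans
    (∑-monoʳ term (s≤s⁻¹ (subst (N <_) (sym (suc-top ℓ)) N<2^ℓ))) (blocks ℓ)
    where
    open ≤-Reasoning
    term : ℕ → ℕ
    term i = N / suc i
    -- `top l` is 2^l - 1: the terms are indexed from 0, so the block of the m from 2^l to 2^(l+1) -
    -- 1 starts at index `top l` and has `suc (top l)` terms.
    top : ℕ → ℕ
    top zero    = 0
    top (suc l) = top l + suc (top l)
    suc-top : ∀ l → suc (top l) ≡ 2 ^ l
    suc-top zero    = refl
    suc-top (suc l) = trans (cong₂ _+_ (suc-top l) (suc-top l)) (cong (2 ^ l +_) (sym (+-identityʳ _)))
    blocks : ∀ l → ∑ term (top l) ≤ l * N
    blocks zero    = z≤n
    blocks (suc l) = begin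
      ∑ term (a + suc a)                           ≡⟨ ∑-+ term a (suc a) ⟩
      ∑ term a + ∑ (λ i → term (a + i)) (suc a)    ≤⟨ +-mono-≤ (blocks l)
                                                       (∑-mono (suc a) (λ i → /-monoʳ-≤ N (s≤s (m≤m+n a i)))) ⟩
      l * N + ∑ (λ _ → N / suc a) (suc a)          ≡⟨ cong (l * N +_) (∑-const (N / suc a) (suc a)) ⟩
      l * N + suc a * (N / suc a)                  ≡⟨ cong (l * N +_) (*-comm (suc a) (N / suc a)) ⟩
      l * N + N / suc a * suc a                    ≤⟨ +-monoʳ-≤ (l * N) (m/n*n≤m N (suc a)) ⟩
      l * N + N                                    ≡⟨ +-comm (l * N) N ⟩
      N + l * N                                    ∎
      where a = top l

  -- Base-g digits along an arithmetic progression

  m<[1+m/n]*n : ∀ m n .{{_ : NonZero n}} → m < suc (m / n) * n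
  m<[1+m/n]*n m n = subst (_< suc (m / n) * n) (sym (m≡m%n+[m/n]*n m n)) (+-monoˡ-< (m / n * n) (m%n<n m n))

  module _ (g : ℕ) .{{_ : NonZero g}} where

    -- The quotient of u by g^i. Dividing first matches the recursion of `fromDigits`, which starts
    -- at the lowest digit; `shift-suc` supplies the other order, needed when digits are revealed
    -- from the top.
    shift : ℕ → ℕ → ℕ
    shift u zero    = u
    shift u (suc i) = shift (u / g) i

    shift-suc : ∀ u i → shift u (suc i) ≡ shift u i / g
    shift-suc u zero    = refl
    shift-suc u (suc i) = shift-suc (u / g) i

    shift-lower : ∀ u i → shift u i * g ^ i ≤ u
    shift-lower u zero    = ≤-reflexive (*-identityʳ u)
    shift-lower u (suc i) = begin
      q * (g * g ^ i)  ≡⟨ reorder q g (g ^ i) ⟩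
      q * g ^ i * g    ≤⟨ *-monoˡ-≤ g (shift-lower (u / g) i) ⟩
      u / g * g        ≤⟨ m/n*n≤m u g ⟩
      u                ∎
      where
      open ≤-Reasoning
      q = shift (u / g) i
      reorder : ∀ x y z → x * (y * z) ≡ x * z * y
      reorder = solve-∀

    shift-upper : ∀ u i → u < suc (shift u i) * g ^ i
    shift-upper u zero    = s≤s (≤-reflexive (sym (*-identityʳ u)))
    shift-upper u (suc i) = begin-strict
      u                    <⟨ m<[1+m/n]*n u g ⟩
      suc (u / g) * g      ≤⟨ *-monoˡ-≤ g (shift-upper (u / g) i) ⟩
      suc q * g ^ i * g    ≡⟨ reorder (suc q) g (g ^ i) ⟩
      suc q * (g * g ^ i)  ∎
      where
      open ≤-Reasoning
      q = shift (u / g) i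
      reorder : ∀ x y z → x * z * y ≡ x * (y * z)
      reorder = solve-∀

    shift-mono : ∀ {u v} i → u ≤ v → shift u i ≤ shift v i
    shift-mono zero    u≤v = u≤v
    shift-mono (suc i) u≤v = shift-mono i (/-monoˡ-≤ g u≤v)

    Avoids : ℕ → ℕ → Set
    Avoids a u = ∀ i → shift u i % g ≢ a

    -- `Avoids` also reads the zeros above the leading digit. The empty list stands for these, and
    -- there a ≥ 1 is what excludes a match.
    avoids-fromDigits : ∀ (a : Digit g) → 1 ≤ toℕ a → ∀ ds → a ∉ ds → Avoids (toℕ a) (fromDigits ds)
    avoids-fromDigits a 1≤a [] _ i eq = contradiction 1≤a (<⇒≱ (s≤s (≤-reflexive (trans (sym eq) (shift-zero i)))))
      where
      shift-zero : ∀ i → shift 0 i % g ≡ 0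
      shift-zero zero    = m<n⇒m%n≡m (>-nonZero⁻¹ g)
      shift-zero (suc i) = trans (cong (λ z → shift z i % g) (0/n≡0 g)) (shift-zero i)
    avoids-fromDigits a 1≤a (d ∷ ds) a∉ zero eq = a∉ (here (Fin.toℕ-injective (trans (sym eq)
      (trans ([m+kn]%n≡m%n (toℕ d) (fromDigits ds) g) (m<n⇒m%n≡m (Fin.toℕ<n d))))))
    avoids-fromDigits a 1≤a (d ∷ ds) a∉ (suc i) eq = avoids-fromDigits a 1≤a ds (λ a∈ → a∉ (there a∈)) i
      (trans (cong (λ z → shift z i % g) (sym /g)) eq)
      where
      /g : (toℕ d + fromDigits ds * g) / g ≡ fromDigits ds
      /g = begin
        (toℕ d + fromDigits ds * g) / g      ≡⟨ +-distrib-/-∣ʳ (toℕ d) (n∣m*n (fromDigits ds)) ⟩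
        toℕ d / g + fromDigits ds * g / g    ≡⟨ cong₂ _+_ (m<n⇒m/n≡0 (Fin.toℕ<n d)) (m*n/n≡m (fromDigits ds) g) ⟩
        fromDigits ds                        ∎
        where open ≡-Reasoning

    -- This g^j is the scale on which the digits of c t + b are read. In the induction on c the
    -- exponent grows exactly when c overtakes g^j.
    exists-power : 1 < g → ∀ c → 1 ≤ c → ∃ λ j → c ≤ g ^ j × g ^ j ≤ g * c
    exists-power 1<g (suc zero)      _ = 0 , ≤-refl , subst (1 ≤_) (sym (*-identityʳ g)) (<⇒≤ 1<g)
    exists-power 1<g (suc c@(suc _)) _ with exists-power 1<g c (s≤s z≤n)
    ... | j , c≤ , ≤gc with suc c ≤? g ^ j
    ... | yes sc≤ = j , sc≤ , ≤-trans ≤gc (*-monoʳ-≤ g (n≤1+n c))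
    ... | no  sc≰ = suc j , ≤-trans sc≤gc (*-monoʳ-≤ g c≤) , *-monoʳ-≤ g (<⇒≤ (≰⇒> sc≰))
      where
      sc≤gc : suc c ≤ g * c
      sc≤gc = ≤-trans (+-monoˡ-≤ c (s≤s z≤n)) (≤-trans (≤-reflexive (cong (c +_) (sym (+-identityʳ c)))) (*-monoˡ-≤ c 1<g))

    module Progression (a h : ℕ) (g≡ : g ≡ a + suc h) (c b : ℕ) (c≥1 : 1 ≤ c)
                       (j : ℕ) (c≤gʲ : c ≤ g ^ j) (gʲ≤gc : g ^ j ≤ g * c) where

      private instance
        c≢0 : NonZero c
        c≢0 = >-nonZero c≥1

      -- Here q prescribes all digits from position k + j upwards. The k digits from position j on
      -- remain to be chosen, and the digits below j are never inspected.
      Block : ℕ → ℕ → ℕ → Set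
      Block k q t = Avoids a (c * t + b) × shift (c * t + b) (k + j) ≡ q

      -- A fixed quotient by g^j confines c t + b to an interval of length g^j ≤ g c, so t lies
      -- among g + 1 consecutive values.
      sparse-block₀ : ∀ q → Sparse 1 (suc g) (Block 0 q)
      sparse-block₀ q = sparse-⊆ bounds (sparse-interval t₀ (suc g))
        where
        open ≤-Reasoning
        G = g ^ j
        t₀ = (q * G ∸ b) / c
        bounds : ∀ {t} → Block 0 q t → t₀ ≤ t × t < t₀ + suc g
        bounds {t} (_ , refl) = lower , *-cancelˡ-< c _ _ upper
          where
          qG≤ : q * G ≤ c * t + b
          qG≤ = shift-lower (c * t + b) j
          lower : t₀ ≤ t
          lower = begin
            (q * G ∸ b) / c      ≤⟨ /-monoˡ-≤ c (≤-trans (∸-monoˡ-≤ b qG≤) (≤-reflexive (m+n∸n≡m (c * t) b))) ⟩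
            c * t / c            ≡⟨ cong (_/ c) (*-comm c t) ⟩
            t * c / c            ≡⟨ m*n/n≡m t c ⟩
            t                    ∎
          ct<′ : c * t < G + (q * G ∸ b)
          ct<′ = +-cancelʳ-< b _ _ (begin-strict
            c * t + b             <⟨ shift-upper (c * t + b) j ⟩
            G + q * G             ≤⟨ +-monoʳ-≤ G (≤-trans (m≤n+m∸n (q * G) b) (≤-reflexive (+-comm b _))) ⟩
            G + (q * G ∸ b + b)   ≡⟨ +-assoc G _ b ⟨
            G + (q * G ∸ b) + b   ∎)
          upper : c * t < c * (t₀ + suc g)
          upper = begin-strict
            c * t                    <⟨ ct<′ ⟩
            G + (q * G ∸ b)          ≤⟨ +-mono-≤ gʲ≤gc (<⇒≤ (m<[1+m/n]*n (q * G ∸ b) c)) ⟩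
            g * c + suc t₀ * c       ≡⟨ reorder g c t₀ ⟩
            c * (t₀ + suc g)         ∎
            where
            reorder : ∀ g c t → g * c + suc t * c ≡ c * (t + suc g)
            reorder = solve-∀

      -- Splitting by the digit at position k + j leaves g - 1 = a + h subblocks: the a digits below
      -- the forbidden one, and the h digits above it, indexed from 0 after subtracting `suc a`.
      sparse-block : ∀ k q → Sparse 1 ((a + h) ^ k * suc g) (Block k q)
      sparse-block zero    q = sparse-≤ (≤-reflexive (sym (+-identityʳ _))) (sparse-block₀ q)
      sparse-block (suc k) q = sparse-≤ (≤-reflexive size)
        (sparse-⊆ split (sparse-∪ (sparse-⋃ (λ d → sparse-block k (d + q * g)) a)
                                  (sparse-⋃ (λ d → sparse-block k (suc a + d + q * g)) h)))
        where
        D = (a + h) ^ k * suc g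
        size : ∑ (λ _ → D) a + ∑ (λ _ → D) h ≡ (a + h) ^ suc k * suc g
        size = trans (cong₂ _+_ (∑-const D a) (∑-const D h))
          (trans (sym (*-distribʳ-+ D a h)) (sym (*-assoc (a + h) ((a + h) ^ k) (suc g))))
        split : ∀ {t} → Block (suc k) q t →
          (∃ λ d → d < a × Block k (d + q * g) t) ⊎ (∃ λ d → d < h × Block k (suc a + d + q * g) t)
        split {t} (av , eq) with <-cmp (shift (c * t + b) (k + j) % g) a
        ... | tri≈ _ ≡a _ = contradiction ≡a (av (k + j))
        ... | tri< <a _ _ = inj₁ (_ , <a , av , v≡)
          where
          v = shift (c * t + b) (k + j)
          v≡ : v ≡ v % g + q * g
          v≡ = trans (m≡m%n+[m/n]*n v g)
            (cong (λ z → v % g + z * g) (trans (sym (shift-suc (c * t + b) (k + j))) eq))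
        ... | tri> _ _ a< = inj₂ (v % g ∸ suc a , <h , av , trans v≡ (cong (_+ q * g) (sym back)))
          where
          v = shift (c * t + b) (k + j)
          v≡ : v ≡ v % g + q * g
          v≡ = trans (m≡m%n+[m/n]*n v g)
            (cong (λ z → v % g + z * g) (trans (sym (shift-suc (c * t + b) (k + j))) eq))
          back : suc a + (v % g ∸ suc a) ≡ v % g
          back = m+[n∸m]≡n a<
          <h : v % g ∸ suc a < h
          <h = +-cancelˡ-< (suc a) _ _ (subst₂ _<_ (sym back) (trans g≡ (+-suc a h)) (m%n<n v g))

      -- A block has g^(k+j) elements, of which k digits vary while t runs over
      -- an interval of length about g^k; so t ≤ T meets at most T/g^k + 2 blocks.
      sparse-progression : ∀ k T → g ^ k ≤ T →
        Sparse (g ^ k) (3 * suc g * (a + h) ^ k * T) (λ t → t ≤ T × Avoids a (c * t + b))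
      sparse-progression k T gᵏ≤T = sparse-rescale size (sparse-⊆ inBlock
        (sparse-⋃ (λ i → sparse-block k (q₀ + i)) (2 + L)))
        where
        open ≤-Reasoning
        instance
          gᵏ≢0 : NonZero (g ^ k)
          gᵏ≢0 = m^n≢0 g k
        L  = T / g ^ k
        q₀ = shift b (k + j)
        D  = (a + h) ^ k * suc g
        -- The two surplus blocks cost 2 g^k, at most 2 T because g^k ≤ T. This is the origin of the
        -- factor 3.
        size : ∑ (λ _ → D) (2 + L) * g ^ k ≤ 3 * suc g * (a + h) ^ k * T * 1
        size = begin
          ∑ (λ _ → D) (2 + L) * g ^ k        ≡⟨ cong (_* g ^ k) (∑-const D (2 + L)) ⟩
          (2 + L) * D * g ^ k                ≡⟨ expand L D (g ^ k) ⟩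
          D * (2 * g ^ k + L * g ^ k)        ≤⟨ *-monoʳ-≤ D (+-mono-≤ (*-monoʳ-≤ 2 gᵏ≤T) (m/n*n≤m T (g ^ k))) ⟩
          D * (2 * T + T)                    ≡⟨ collect g T ((a + h) ^ k) ⟩
          3 * suc g * (a + h) ^ k * T * 1    ∎
          where
          expand : ∀ L D w → (2 + L) * D * w ≡ D * (2 * w + L * w)
          expand = solve-∀
          collect : ∀ g T w → w * suc g * (2 * T + T) ≡ 3 * suc g * w * T * 1
          collect = solve-∀
        inBlock : ∀ {t} → t ≤ T × Avoids a (c * t + b) →
          ∃ λ i → i < 2 + L × Block k (q₀ + i) t
        inBlock {t} (t≤T , av) = v ∸ q₀ , +-cancelˡ-< q₀ _ _ (subst (_< q₀ + (2 + L)) (sym back) v<) ,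
          av , sym back
          where
          v = shift (c * t + b) (k + j)
          back : q₀ + (v ∸ q₀) ≡ v
          back = m+[n∸m]≡n (shift-mono (k + j) (m≤n+m b (c * t)))
          G = g ^ (k + j)
          gᵏ⁺ʲ : G ≡ g ^ k * g ^ j
          gᵏ⁺ʲ = ^-distribˡ-+-* g k j
          -- Here c t ≤ (L + 1) G and b < (q₀ + 1) G, so the sum is below (q₀ + L + 2) G.
          v< : v < q₀ + (2 + L)
          v< = *-cancelʳ-< G v _ (begin-strict
            v * G                          ≤⟨ shift-lower (c * t + b) (k + j) ⟩
            c * t + b                      <⟨ +-mono-≤-< (*-mono-≤ c≤gʲ (≤-trans t≤T (<⇒≤ (m<[1+m/n]*n T (g ^ k)))))
                                                         (shift-upper b (k + j)) ⟩
            g ^ j * (suc L * g ^ k) + suc q₀ * G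
                                           ≡⟨ cong (_+ suc q₀ * G) (trans (reorder (g ^ j) (suc L) (g ^ k)) (cong (suc L *_) (sym gᵏ⁺ʲ))) ⟩
            suc L * G + suc q₀ * G         ≡⟨ collect L q₀ G ⟩
            (q₀ + (2 + L)) * G             ∎)
            where
            reorder : ∀ x y z → x * (y * z) ≡ y * (z * x)
            reorder = solve-∀
            collect : ∀ L q G → suc L * G + suc q * G ≡ (q + (2 + L)) * G
            collect = solve-∀

  -- The sum of proper divisors of m p

  ∈-properDivisors⁺ : ∀ {d n} → d ∣ n → d < n → d ∈ properDivisors n
  ∈-properDivisors⁺ {n = n} d∣n d<n = ∈-filter⁺ (_∣? n) (∈-upTo⁺ d<n) d∣n

  ∈-properDivisors⁻ : ∀ {d n} → d ∈ properDivisors n → d < n × d ∣ n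
  ∈-properDivisors⁻ {n = n} d∈ with ∈-filter⁻ (_∣? n) {xs = upTo n} d∈
  ... | d∈upTo , d∣n = ∈-upTo⁻ d∈upTo , d∣n

  properDivisors-unique : ∀ n → Unique (properDivisors n)
  properDivisors-unique n = Unique.filter⁺ (_∣? n) (Unique.upTo⁺ n)

  sum-map-* : ∀ c xs → sum (map (c *_) xs) ≡ c * sum xs
  sum-map-* c []       = sym (*-zeroʳ c)
  sum-map-* c (x ∷ xs) = trans (cong (c * x +_) (sum-map-* c xs)) (sym (*-distribˡ-+ c x (sum xs)))

  -- Euclid's lemma is applied to the cofactor: in m p = q d the prime p must divide q, and
  -- cancelling it leaves m as a multiple of d.
  prime∤⇒∣ : ∀ {p m d} → Prime p → ¬ p ∣ d → d ∣ m * p → d ∣ m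
  prime∤⇒∣ {p} {m} {d} pp p∤d (divides q m*p≡q*d) with euclidsLemma q d pp (subst (p ∣_) m*p≡q*d (n∣m*n m))
  ... | inj₂ p∣d = contradiction p∣d p∤d
  ... | inj₁ (divides r refl) = divides r (*-cancelʳ-≡ m (r * d) p {{prime⇒nonZero pp}}
          (trans m*p≡q*d (reorder r p d)))
    where
    reorder : ∀ r p d → r * p * d ≡ r * d * p
    reorder = solve-∀

  prime≥2 : ∀ {p} → Prime p → 2 ≤ p
  prime≥2 pp = nonTrivial⇒n>1 _ {{prime⇒nonTrivial pp}}

  -- The proper divisors of m p are those divisible by p, which are p times a
  -- proper divisor of m, and the others, which are the divisors of m.
  s-*-prime : ∀ {m p} → .{{NonZero m}} → Prime p → ¬ p ∣ m → s (m * p) ≡ s m * p + (m + s m)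
  s-*-prime {m} {p} pp p∤m = begin
    sum (properDivisors (m * p))
      ≡⟨ sum-↭ (∼bag⇒↭ (unique∧set⇒bag (properDivisors-unique (m * p)) uniq (mk⇔ to from))) ⟩
    sum (map (p *_) D ++ (m ∷ D))                      ≡⟨ sum-++ (map (p *_) D) (m ∷ D) ⟩
    sum (map (p *_) D) + (m + s m)                     ≡⟨ cong (_+ (m + s m)) (trans (sum-map-* p D) (*-comm p (s m))) ⟩
    s m * p + (m + s m)                                ∎
    where
    open ≡-Reasoning
    D = properDivisors m
    instance
      p≢0 : NonZero p
      p≢0 = prime⇒nonZero pp
      mp≢0 : NonZero (m * p)
      mp≢0 = m*n≢0 m p
    m<mp : m < m * p
    m<mp = m<m*n m p (prime≥2 pp)
    p∣⇒∉ : ∀ {d} → p ∣ d → d ∉ m ∷ D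
    p∣⇒∉ p∣d (here refl) = p∤m p∣d
    p∣⇒∉ p∣d (there d∈)  = p∤m (∣-trans p∣d (proj₂ (∈-properDivisors⁻ d∈)))
    uniq : Unique (map (p *_) D ++ (m ∷ D))
    uniq = Unique.++⁺ (Unique.map⁺ (λ {x} {y} → *-cancelˡ-≡ x y p) (properDivisors-unique m))
      (All.tabulate (λ { d∈ refl → <-irrefl refl (proj₁ (∈-properDivisors⁻ {n = m} d∈)) }) ∷ properDivisors-unique m)
      (λ { (d∈₁ , d∈₂) → let e , _ , d≡ = ∈-map⁻ (p *_) d∈₁ in p∣⇒∉ (subst (p ∣_) (sym d≡) (m∣m*n e)) d∈₂ })
    to : ∀ {d} → d ∈ properDivisors (m * p) → d ∈ map (p *_) D ++ (m ∷ D)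
    to {d} d∈ with ∈-properDivisors⁻ {n = m * p} d∈ | p ∣? d
    ... | d< , d∣ | yes (divides e refl) = ∈-++⁺ˡ (subst (_∈ map (p *_) D) (*-comm p e)
      (∈-map⁺ (p *_) (∈-properDivisors⁺ (*-cancelʳ-∣ p d∣) (*-cancelʳ-< p e m d<))))
    ... | d< , d∣ | no p∤d with prime∤⇒∣ pp p∤d d∣
    ...   | d∣m with m≤n⇒m<n∨m≡n (∣⇒≤ d∣m)
    ...     | inj₁ d<m  = ∈-++⁺ʳ (map (p *_) D) (there (∈-properDivisors⁺ d∣m d<m))
    ...     | inj₂ refl = ∈-++⁺ʳ (map (p *_) D) (here refl)
    from : ∀ {d} → d ∈ map (p *_) D ++ (m ∷ D) → d ∈ properDivisors (m * p)
    from {d} d∈ with ∈-++⁻ (map (p *_) D) d∈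
    ... | inj₂ (here refl) = ∈-properDivisors⁺ (m∣m*n p) m<mp
    ... | inj₂ (there d∈D) with ∈-properDivisors⁻ {n = m} d∈D
    ...   | d<m , d∣m = ∈-properDivisors⁺ (∣m⇒∣m*n p d∣m) (<-trans d<m m<mp)
    from {d} d∈ | inj₁ d∈pD with ∈-map⁻ (p *_) d∈pD
    ... | e , e∈D , refl with ∈-properDivisors⁻ {n = m} e∈D
    ...   | e<m , e∣m = subst (_∈ properDivisors (m * p)) (*-comm e p)
            (∈-properDivisors⁺ (*-monoˡ-∣ p e∣m) (*-monoˡ-< p e<m))

  1≤s : ∀ {m} → 2 ≤ m → 1 ≤ s m
  1≤s {m} 2≤m = one-∈ (∈-properDivisors⁺ (1∣ m) 2≤m)
    where
    one-∈ : ∀ {xs} → 1 ∈ xs → 1 ≤ sum xs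
    one-∈ (here refl)              = s≤s z≤n
    one-∈ (there {x = x} 1∈) = ≤-trans (one-∈ 1∈) (m≤n+m _ x)

  -- Smooth numbers, square divisors and the main case n = m t

  Smooth : ℕ → ℕ → Set
  Smooth y n = ∀ {p} → Prime p → p ∣ n → p ≤ y

  large-prime-or-smooth : ∀ y n → .{{NonZero n}} → (∃ λ p → y < p × Prime p × p ∣ n) ⊎ Smooth y n
  large-prime-or-smooth y n with anyUpTo? (λ p → (y <? p) ×-dec (prime? p ×-dec (p ∣? n))) (suc n)
  ... | yes (p , _ , h) = inj₁ (p , h)
  ... | no ¬h = inj₂ (λ {p} pp p∣n → ≮⇒≥ (λ y<p → ¬h (p , s≤s (∣⇒≤ p∣n) , y<p , pp , p∣n)))

  smooth-1⇒≡1 : ∀ {n} → .{{NonZero n}} → Smooth 1 n → n ≡ 1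
  smooth-1⇒≡1 {n} sm with factorise n
  ... | record { factors = [] ; isFactorisation = n≡ } = n≡
  ... | record { factors = p ∷ ps ; isFactorisation = n≡ ; factorsPrime = pp ∷ _ } =
    contradiction (prime≥2 pp) (≤⇒≯ (sm pp (subst (p ∣_) (sym n≡) (m∣m*n (product ps)))))

  -- Rankin's bound Ψ(x, y) ≤ x z^(-r) F(y), valid for n ≥ Y^r when all integers
  -- up to y are used in place of the primes: with z = 3/2 and F(y) = y², it
  -- reduces to F(y - 1) + (z / y) F(y) ≤ F(y).
  sparse-smooth : ∀ {Y} → 2 ≤ Y → ∀ r y x → suc y ≤ Y →
    Sparse (3 ^ r) (x * (suc y * suc y) * 2 ^ r) (λ n → 1 ≤ n × n ≤ x × Smooth (suc y) n × Y ^ r ≤ n)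
  sparse-smooth 2≤Y zero y x y<Y = sparse-≤ x≤ (sparse-⊆ (λ { (1≤n , n≤x , _) → 1≤n , s≤s n≤x }) (sparse-interval 1 x))
    where
    x≤ : x ≤ x * (suc y * suc y) * 1
    x≤ = ≤-trans (m≤m*n x (suc y * suc y)) (≤-reflexive (sym (*-identityʳ _)))
  sparse-smooth {Y} 2≤Y (suc r) zero x y<Y = sparse-≤ z≤n (sparse-∅ none)
    where
    none : ∀ {n} → ¬ (1 ≤ n × n ≤ x × Smooth 1 n × Y * Y ^ r ≤ n)
    none (1≤n , _ , sm , Y≤n) = <⇒≱ (≤-trans 2≤Y (m≤m*n Y (Y ^ r) {{m^n≢0 Y r {{>-nonZero (<⇒≤ 2≤Y)}}}}))
      (≤-trans Y≤n (≤-reflexive (smooth-1⇒≡1 {{>-nonZero 1≤n}} sm)))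
  sparse-smooth {Y} 2≤Y (suc r) (suc u) x y<Y = sparse-≤ size (sparse-⊆ split
    (sparse-∪ (sparse-smooth 2≤Y (suc r) u x (<⇒≤ y<Y))
      -- For the multiples of y the quotient may contain y again, so y stays and r drops. The
      -- condition Y^r ≤ q survives because y ≤ Y.
      (sparse-map (_* y) (sparse-rescale {d′ = 3 * (x / y * (y * y) * 2 ^ r)} {{m^n≢0 3 r}} tripled
        (sparse-smooth 2≤Y r (suc u) (x / y) y<Y)))))
    where
    open ≤-Reasoning
    y = 2 + u
    t = 2 ^ r
    tripled : x / y * (y * y) * 2 ^ r * 3 ^ suc r ≤ 3 * (x / y * (y * y) * 2 ^ r) * 3 ^ r
    tripled = ≤-reflexive (reorder (x / y * (y * y) * 2 ^ r) (3 ^ r))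
      where
      reorder : ∀ d w → d * (3 * w) ≡ 3 * d * w
      reorder = solve-∀
    size : x * (suc u * suc u) * 2 ^ suc r + 3 * (x / y * (y * y) * 2 ^ r) ≤ x * (y * y) * 2 ^ suc r
    size = begin
      x * (suc u * suc u) * (2 * t) + 3 * (x / y * (y * y) * t)
        ≡⟨ cong (x * (suc u * suc u) * (2 * t) +_) (reorder (x / y) y t) ⟩
      x * (suc u * suc u) * (2 * t) + 3 * (x / y * y * (y * t))
        ≤⟨ +-monoʳ-≤ (x * (suc u * suc u) * (2 * t)) (*-monoʳ-≤ 3 (*-monoˡ-≤ (y * t) (m/n*n≤m x y))) ⟩
      x * (suc u * suc u) * (2 * t) + 3 * (x * (y * t))
        ≤⟨ m≤m+n _ (x * t * u) ⟩
      x * (suc u * suc u) * (2 * t) + 3 * (x * (y * t)) + x * t * u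
        ≡⟨ collect x u t ⟩
      x * (y * y) * (2 * t) ∎
      where
      reorder : ∀ q y t → 3 * (q * (y * y) * t) ≡ 3 * (q * y * (y * t))
      reorder = solve-∀
      collect : ∀ x u t → x * (suc u * suc u) * (2 * t) + 3 * (x * ((2 + u) * t)) + x * t * u ≡
                          x * ((2 + u) * (2 + u)) * (2 * t)
      collect = solve-∀
    split : ∀ {n} → 1 ≤ n × n ≤ x × Smooth y n × Y * Y ^ r ≤ n →
      (1 ≤ n × n ≤ x × Smooth (suc u) n × Y * Y ^ r ≤ n) ⊎
      (∃ λ q → (1 ≤ q × q ≤ x / y × Smooth y q × Y ^ r ≤ q) × n ≡ q * y)
    split {n} (1≤n , n≤x , sm , Yʳ≤n) with y ∣? n
    ... | no y∤n = inj₁ (1≤n , n≤x , (λ pp p∣n → s≤s⁻¹ (≤∧≢⇒< (sm pp p∣n) (λ { refl → y∤n p∣n }))) , Yʳ≤n)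
    ... | yes (divides q refl) = inj₂ (q , (1≤q , q≤ , (λ pp p∣q → sm pp (∣m⇒∣m*n y p∣q)) , Yʳ≤q) , refl)
      where
      1≤q : 1 ≤ q
      1≤q = >-nonZero⁻¹ q {{m*n≢0⇒m≢0 q {{>-nonZero 1≤n}}}}
      q≤ : q ≤ x / y
      q≤ = ≤-trans (≤-reflexive (sym (m*n/n≡m q y))) (/-monoˡ-≤ y n≤x)
      Yʳ≤q : Y ^ r ≤ q
      Yʳ≤q = *-cancelʳ-≤ (Y ^ r) q y (begin
        Y ^ r * y  ≤⟨ *-monoʳ-≤ (Y ^ r) y<Y ⟩
        Y ^ r * Y  ≡⟨ *-comm (Y ^ r) Y ⟩
        Y * Y ^ r  ≤⟨ Yʳ≤n ⟩
        q * y      ∎)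

  -- Since N / p² ≤ (N / p) / Y, a harmonic sum suffices.
  sparse-square : ∀ Y N → .{{NonZero Y}} →
    Sparse Y (∑ (λ i → N / suc i) N) (λ n → 1 ≤ n × n ≤ N × ∃ λ p → Y < p × p * p ∣ n)
  sparse-square Y N = sparse-⊆ split (sparse-⋃ piece N)
    where
    Piece : ℕ → ℕ → Set
    Piece i n = ∃ λ q → (1 ≤ q × q < 1 + N / suc i / Y) × n ≡ q * (suc i * suc i)
    piece : ∀ i → Sparse Y (N / suc i) (Piece i)
    piece i = sparse-map (_* (suc i * suc i)) (sparse-rescale
      (≤-trans (m/n*n≤m (N / suc i) Y) (≤-reflexive (sym (*-identityʳ _))))
      (sparse-interval 1 (N / suc i / Y)))
    split : ∀ {n} → 1 ≤ n × n ≤ N × (∃ λ p → Y < p × p * p ∣ n) → ∃ λ i → i < N × Piece i n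
    split (1≤n , n≤N , p@(suc i) , Y<p , divides q refl) = i , i<N , q , (1≤q , s≤s q≤) , refl
      where
      open ≤-Reasoning
      instance
        q≢0 : NonZero q
        q≢0 = m*n≢0⇒m≢0 q {{>-nonZero 1≤n}}
      1≤q : 1 ≤ q
      1≤q = >-nonZero⁻¹ q
      i<N : i < N
      i<N = ≤-trans (≤-trans (m≤m*n p p) (m≤n*m (p * p) q)) n≤N
      q≤ : q ≤ N / p / Y
      q≤ = begin
        q                        ≡⟨ m*n/n≡m q Y ⟨
        q * Y / Y                ≤⟨ /-monoˡ-≤ Y (*-monoʳ-≤ q (<⇒≤ Y<p)) ⟩
        q * p / Y                ≡⟨ /-congˡ (m*n/n≡m (q * p) p) ⟨
        q * p * p / p / Y        ≤⟨ /-monoˡ-≤ Y (/-monoˡ-≤ p (≤-trans (≤-reflexive (*-assoc q p p)) n≤N)) ⟩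
        N / p / Y                ∎

  module _ (g : ℕ) .{{_ : NonZero g}} (1<g : 1 < g) (a h : ℕ) (g≡ : g ≡ a + suc h) where

    sparse-coprime : ∀ k N → Sparse (g ^ k) (3 * suc g * (a + h) ^ k * ∑ (λ i → N / suc i) N)
      (λ n → n ≤ N × ∃ λ m → ∃ λ t → n ≡ m * t × 2 ≤ m × g ^ k ≤ t × Avoids g a (s m * t + (m + s m)))
    sparse-coprime k N = sparse-≤ (≤-reflexive (∑-*ˡ (3 * suc g * (a + h) ^ k) (λ i → N / suc i) N))
      (sparse-⊆ split (sparse-⋃ piece N))
      where
      Piece : ℕ → ℕ → Set
      Piece i n = ∃ λ t →
        (2 ≤ suc i × t ≤ N / suc i × g ^ k ≤ t × Avoids g a (s (suc i) * t + (suc i + s (suc i)))) × n ≡ suc i * t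
      piece : ∀ i → Sparse (g ^ k) (3 * suc g * (a + h) ^ k * (N / suc i)) (Piece i)
      piece i = sparse-map (suc i *_) piece′
        where
        T = N / suc i
        piece′ : Sparse (g ^ k) (3 * suc g * (a + h) ^ k * T)
          (λ t → 2 ≤ suc i × t ≤ T × g ^ k ≤ t × Avoids g a (s (suc i) * t + (suc i + s (suc i))))
        piece′ with 2 ≤? suc i | g ^ k ≤? T
        ... | no ¬2≤ | _     = sparse-≤ z≤n (sparse-∅ (λ { (2≤ , _) → ¬2≤ 2≤ }))
        -- If T < g^k, no t with g^k ≤ t ≤ T is left to count. In the remaining case g^k ≤ T, which
        -- keeps the surplus blocks of the progression harmless.
        ... | _      | no ¬≤ = sparse-≤ z≤n (sparse-∅ (λ { (_ , t≤ , ≤t , _) → ¬≤ (≤-trans ≤t t≤) }))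
        ... | yes 2≤ | yes gᵏ≤T with exists-power g 1<g (s (suc i)) (1≤s 2≤)
        ... | j , s≤gʲ , gʲ≤gs = sparse-⊆ (λ { (_ , t≤ , _ , av) → t≤ , av })
          (Progression.sparse-progression g a h g≡ (s (suc i)) (suc i + s (suc i)) (1≤s 2≤) j s≤gʲ gʲ≤gs k T gᵏ≤T)
      split : ∀ {n} → (n ≤ N × ∃ λ m → ∃ λ t → n ≡ m * t × 2 ≤ m × g ^ k ≤ t × Avoids g a (s m * t + (m + s m))) →
        ∃ λ i → i < N × Piece i n
      split (n≤N , m@(suc i) , t , refl , 2≤m , gᵏ≤t , av) = i , ≤-trans (m≤m*n m t) n≤N , t , (2≤m , t≤ , gᵏ≤t , av) , refl
        where
        instance
          t≢0 : NonZero t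
          t≢0 = >-nonZero (≤-trans (m^n>0 g k) gᵏ≤t)
        t≤ : t ≤ N / m
        t≤ = ≤-trans (≤-reflexive (trans (sym (m*n/n≡m t m)) (/-congˡ (*-comm t m)))) (/-monoˡ-≤ m n≤N)

  -- Choice of the parameters and the combined count

  ^-distribʳ-* : ∀ k m n → (m * n) ^ k ≡ m ^ k * n ^ k
  ^-distribʳ-* zero    m n = refl
  ^-distribʳ-* (suc k) m n = trans (cong (m * n *_) (^-distribʳ-* k m n)) (reorder m n (m ^ k) (n ^ k))
    where
    reorder : ∀ m n x y → m * n * (x * y) ≡ m * x * (n * y)
    reorder = solve-∀

  n<2^n : ∀ n → n < 2 ^ n
  n<2^n zero    = s≤s z≤n
  n<2^n (suc n) = ≤-trans (+-mono-≤ (m^n>0 2 n) (n<2^n n)) (≤-reflexive (cong (2 ^ n +_) (sym (+-identityʳ _))))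

  -- Bernoulli's inequality (1 + 1/h)^k ≥ 1 + k/h.
  bernoulli : ∀ h k → h ^ k * (h + k) ≤ h * suc h ^ k
  bernoulli h zero    = ≤-reflexive (base h)
    where
    base : ∀ h → 1 * (h + 0) ≡ h * 1
    base = solve-∀
  bernoulli h (suc k) = begin
    h * h ^ k * (h + suc k)              ≤⟨ m≤m+n _ (h ^ k * k) ⟩
    h * h ^ k * (h + suc k) + h ^ k * k  ≡⟨ expand h k (h ^ k) ⟩
    suc h * (h ^ k * (h + k))            ≤⟨ *-monoʳ-≤ (suc h) (bernoulli h k) ⟩
    suc h * (h * suc h ^ k)              ≡⟨ reorder h (suc h ^ k) ⟩
    h * (suc h * suc h ^ k)              ∎
    where
    open ≤-Reasoning
    expand : ∀ h k x → h * x * (h + suc k) + x * k ≡ suc h * (x * (h + k))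
    expand = solve-∀
    reorder : ∀ h x → suc h * (h * x) ≡ h * (suc h * x)
    reorder = solve-∀

  bracket : ∀ (f : ℕ → ℕ) N M → f 0 ≤ N → N < f M → ∃ λ k → f k ≤ N × N < f (suc k)
  bracket f N zero    f0≤N N<f0 = contradiction f0≤N (<⇒≱ N<f0)
  bracket f N (suc M) f0≤N N<f with f M ≤? N
  ... | yes fM≤N = M , fM≤N , N<f
  ... | no  fM≰N = bracket f N M f0≤N (≰⇒> fM≰N)

  module CountBound (e : ℕ) (1≤e : 1 ≤ e) where

    g B A : ℕ
    g = suc e
    B = 4 * (g * g)
    A = suc B

    -- Bernoulli gives (3/2)^B ≥ 1 + B/2 = 1 + 2 g^2, which explains `B` = 4 g^2. Raised to the
    -- power k, the saving (3/2)^r with r = B k covers Y^2 = g^(2k) and leaves 2^k over.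
    2^≤3^ : g * g * 2 ^ B * 2 ≤ 3 ^ B
    2^≤3^ = *-cancelˡ-≤ 2 (begin
      2 * (g * g * 2 ^ B * 2)  ≤⟨ m≤n+m _ (2 ^ B * 2) ⟩
      2 ^ B * 2 + 2 * (g * g * 2 ^ B * 2)  ≡⟨ collect (g * g) (2 ^ B) ⟩
      2 ^ B * (2 + B)          ≤⟨ bernoulli 2 B ⟩
      2 * 3 ^ B                ∎)
      where
      open ≤-Reasoning
      collect : ∀ q x → x * 2 + 2 * (q * x * 2) ≡ x * (2 + 4 * q)
      collect = solve-∀

    g^≤2^e^ : ∀ k → g ^ k ≤ 2 ^ k * e ^ k
    g^≤2^e^ k = ≤-trans (^-monoˡ-≤ k g≤2e) (≤-reflexive (^-distribʳ-* k 2 e))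
      where
      g≤2e : g ≤ 2 * e
      g≤2e = ≤-trans (+-monoˡ-≤ e 1≤e) (≤-reflexive (cong (e +_) (sym (+-identityʳ e))))

    -- The smooth n and the n below Y^r save only a factor 2^k. As g ≤ 2 e, this is at least the
    -- saving (g / e)^k of a missing digit, so all cases can share the weight g^k.
    widen : ∀ {k N P} → Sparse (2 ^ k) N P → Sparse (g ^ k) (N * e ^ k) P
    widen {k} {N} = sparse-rescale {{m^n≢0 2 k}} (≤-trans (*-monoʳ-≤ N (g^≤2^e^ k)) (≤-reflexive (reorder N (2 ^ k) (e ^ k))))
      where
      reorder : ∀ N x y → N * (x * y) ≡ N * y * x
      reorder = solve-∀

    module _ (g≥2 : 2 ≤ g) (a : Digit g) (1≤a : 1 ≤ toℕ a) (k N ℓ : ℕ) (1≤k : 1 ≤ k)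
             (large : g ^ (B * (k * k)) * 2 ^ k ≤ N) (N<2^ℓ : N < 2 ^ ℓ) where

      private
        open ≤-Reasoning
        Y = g ^ k
        r = B * k
        H = ∑ (λ i → N / suc i) N
        h = e ∸ toℕ a
        a+h : toℕ a + h ≡ e
        a+h = m+[n∸m]≡n (s≤s⁻¹ (Fin.toℕ<n a))
        g≡ : g ≡ toℕ a + suc h
        g≡ = trans (cong suc (sym a+h)) (sym (+-suc (toℕ a) h))
        2≤Y : 2 ≤ Y
        2≤Y = ≤-trans g≥2 (≤-trans (≤-reflexive (sym (^-identityʳ g))) (^-monoʳ-≤ g 1≤k))
        instance
          Y≢0 : NonZero Y
          Y≢0 = m^n≢0 g k

        Y^r : Y ^ r ≡ g ^ (B * (k * k))
        Y^r = trans (^-*-assoc g k r) (cong (g ^_) (reorder k B))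
          where
          reorder : ∀ k B → k * (B * k) ≡ B * (k * k)
          reorder = solve-∀

        small : Sparse Y (N * e ^ k) (_< Y ^ r)
        small = widen {k} {N} (sparse-rescale (begin
            Y ^ r * 2 ^ k  ≡⟨ cong (_* 2 ^ k) Y^r ⟩
            g ^ (B * (k * k)) * 2 ^ k  ≤⟨ large ⟩
            N              ≡⟨ *-identityʳ N ⟨
            N * 1          ∎)
          (sparse-⊆ (λ n< → z≤n , n<) (sparse-interval 0 (Y ^ r))))

        smooth : Sparse Y (N * e ^ k) (λ n → 1 ≤ n × n ≤ N × Smooth Y n × Y ^ r ≤ n)
        smooth = widen {k} {N} (sparse-rescale {{m^n≢0 3 r}} (begin
            N * (Y * Y) * 2 ^ r * 2 ^ k            ≡⟨ reorder N (Y * Y) (2 ^ r) (2 ^ k) ⟩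
            N * (Y * Y * 2 ^ r * 2 ^ k)            ≡⟨ cong (λ z → N * z) powers ⟩
            N * (g * g * 2 ^ B * 2) ^ k            ≤⟨ *-monoʳ-≤ N (^-monoˡ-≤ k 2^≤3^) ⟩
            N * (3 ^ B) ^ k                        ≡⟨ cong (N *_) (^-*-assoc 3 B k) ⟩
            N * 3 ^ r                              ∎)
          (subst (λ y → Sparse (3 ^ r) (N * (y * y) * 2 ^ r) (λ n → 1 ≤ n × n ≤ N × Smooth y n × Y ^ r ≤ n)) (suc-pred Y)
            (sparse-smooth 2≤Y r (pred Y) N (≤-reflexive (suc-pred Y)))))
          where
          reorder : ∀ N x y z → N * x * y * z ≡ N * (x * y * z)
          reorder = solve-∀
          powers : Y * Y * 2 ^ r * 2 ^ k ≡ (g * g * 2 ^ B * 2) ^ k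
          powers = sym (trans (^-distribʳ-* k (g * g * 2 ^ B) 2) (cong (_* 2 ^ k)
            (trans (^-distribʳ-* k (g * g) (2 ^ B)) (cong₂ _*_ (^-distribʳ-* k g g) (^-*-assoc 2 B k)))))

        avoids : ∀ {n} → CompositeMissing g g≥2 a n → Avoids g (toℕ a) (s n)
        avoids {n} (_ , a∉) = subst (Avoids g (toℕ a)) (proj₂ (toDigits g {fromWitness g≥2} (s n)))
          (avoids-fromDigits g a 1≤a (digits g g≥2 (s n)) a∉)

        Small Smoothₙ Square Coprime : ℕ → Set
        Small   n = n < Y ^ r
        Smoothₙ n = 1 ≤ n × n ≤ N × Smooth Y n × Y ^ r ≤ n
        Square  n = 1 ≤ n × n ≤ N × ∃ λ p → Y < p × p * p ∣ n
        Coprime n = n ≤ N × ∃ λ m → ∃ λ t → n ≡ m * t × 2 ≤ m × Y ≤ t × Avoids g (toℕ a) (s m * t + (m + s m))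

        cases : ∀ {n} → n ≤ N × CompositeMissing g g≥2 a n → (Small n ⊎ Smoothₙ n) ⊎ (Square n ⊎ Coprime n)
        cases {n} (n≤N , miss@(comp , _)) with n <? Y ^ r
        ... | yes n< = inj₁ (inj₁ n<)
        ... | no  n≮ with large-prime-or-smooth Y n {{composite⇒nonZero comp}}
        ... | inj₂ sm = inj₁ (inj₂ (>-nonZero⁻¹ n {{composite⇒nonZero comp}} , n≤N , sm , ≮⇒≥ n≮))
        ... | inj₁ (p , Y<p , pp , divides m refl) with p ∣? m
        ... | yes p∣m = inj₂ (inj₁ (>-nonZero⁻¹ n {{composite⇒nonZero comp}} , n≤N , p , Y<p , *-monoˡ-∣ p p∣m))
        ... | no  p∤m = inj₂ (inj₂ (n≤N , m , p , refl , 2≤m , <⇒≤ Y<p , subst (Avoids g (toℕ a)) (s-*-prime pp p∤m) (avoids miss)))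
          where
          instance
            m≢0 : NonZero m
            m≢0 = m*n≢0⇒m≢0 m {{composite⇒nonZero comp}}
          2≤m : 2 ≤ m
          2≤m with m≤n⇒m<n∨m≡n (>-nonZero⁻¹ m)
          ... | inj₁ 1<m  = 1<m
          -- If m = 1, then n = p is prime, against compositeness.
          ... | inj₂ refl = contradiction (subst Prime (sym (*-identityˡ p)) pp) (composite⇒¬prime comp)

      -- The coefficient adds the four cases: 1 each for the small and the smooth n, ℓ for the
      -- square divisors and 3 (g + 1) ℓ for the progressions, where ℓ comes from the harmonic sum H
      -- ≤ ℓ N.
      count-bound-log : count (compositeMissing? g g≥2 a) N * g ^ k ≤ (2 + ℓ + 3 * suc g * ℓ) * N * e ^ k
      count-bound-log = ≤-trans
        (sparse⇒count (compositeMissing? g g≥2 a) N (sparse-⊆ cases (sparse-∪ (sparse-∪ small smooth)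
          (sparse-∪ (sparse-square Y N) (sparse-coprime g g≥2 (toℕ a) h g≡ k N))))) (begin
        N * e ^ k + N * e ^ k + (H + 3 * suc g * (toℕ a + h) ^ k * H)
          ≡⟨ cong (λ z → N * e ^ k + N * e ^ k + (H + 3 * suc g * z ^ k * H)) a+h ⟩
        N * e ^ k + N * e ^ k + (H + 3 * suc g * e ^ k * H)
          ≤⟨ +-monoʳ-≤ (N * e ^ k + N * e ^ k) (+-mono-≤ (m≤m*n H (e ^ k) {{m^n≢0 e k {{>-nonZero 1≤e}}}}) ≤-refl) ⟩
        N * e ^ k + N * e ^ k + (H * e ^ k + 3 * suc g * e ^ k * H)
          ≤⟨ +-monoʳ-≤ (N * e ^ k + N * e ^ k) (+-mono-≤ (*-monoˡ-≤ (e ^ k) H≤) (*-monoʳ-≤ (3 * suc g * e ^ k) H≤)) ⟩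
        N * e ^ k + N * e ^ k + (ℓ * N * e ^ k + 3 * suc g * e ^ k * (ℓ * N))
          ≡⟨ collect N (e ^ k) ℓ g ⟩
        (2 + ℓ + 3 * suc g * ℓ) * N * e ^ k ∎)
        where
        H≤ : H ≤ ℓ * N
        H≤ = ∑-harmonic N ℓ N<2^ℓ
        collect : ∀ N x ℓ g → N * x + N * x + (ℓ * N * x + 3 * suc g * x * (ℓ * N)) ≡ (2 + ℓ + 3 * suc g * ℓ) * N * x
        collect = solve-∀

    -- 1 - 1/W with W = 2g² dominates (1 - 1/g)(1 + 1/(2g))², where the second
    -- factor absorbs the square of a logarithm.
    V : ℕ
    V = 1 + 4 * e + 2 * (e * e)

    ratio : e * (suc (2 * g) * suc (2 * g)) * suc V ≤ V * (g * (2 * g * (2 * g)))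
    -- With `suc V` = 2 g^2, the left factor is (1 - 1/g)(1 + 1/(2g))^2 = 1 - 3/(4 g^2) - 1/(4 g^3).
    -- Its distance to 1 - 1/(2 g^2), multiplied by 8 g^5, is the added 2 g^3 + 2 g^2.
    ratio = ≤-trans (m≤m+n _ (2 * (g * g * g) + 2 * (g * g))) (≤-reflexive (identity e))
      where
      identity : ∀ e → e * (suc (2 * suc e) * suc (2 * suc e)) * (2 + 4 * e + 2 * (e * e))
                        + (2 * (suc e * suc e * suc e) + 2 * (suc e * suc e)) ≡
                       (1 + 4 * e + 2 * (e * e)) * (suc e * (2 * suc e * (2 * suc e)))
      identity = solve-∀

    K₁ K₂ : ℕ
    K₁ = (6 + 3 * g) * (g * A)
    K₂ = K₁ * (2 * g * (2 * g))

    -- With D = 2 g, Bernoulli gives k + 1 ≤ D (1 + 1/D)^k. Thus (k + 1)^2 costs D^2 in the constant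
    -- and (1 + 1/D)^2 in the base of the power, and `ratio` absorbs the latter. The common factor
    -- only clears denominators.
    absorb-log : ∀ c N k → c * g ^ k ≤ K₁ * (suc k * suc k) * N * e ^ k → c * suc V ^ k ≤ K₂ * N * V ^ k
    absorb-log c N k c≤ = *-cancelʳ-≤ _ _ (Gᵏ * (Dᵏ * Dᵏ))
      {{m*n≢0 Gᵏ (Dᵏ * Dᵏ) {{m^n≢0 g k}} {{m*n≢0 Dᵏ Dᵏ {{m^n≢0 D k}} {{m^n≢0 D k}}}}}} (begin
      c * Wᵏ * (Gᵏ * (Dᵏ * Dᵏ))
        ≡⟨ reorder₁ c Wᵏ Gᵏ Dᵏ ⟩
      c * Gᵏ * (Dᵏ * Dᵏ * Wᵏ)
        ≤⟨ *-monoˡ-≤ (Dᵏ * Dᵏ * Wᵏ) c≤ ⟩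
      K₁ * (suc k * suc k) * N * e ^ k * (Dᵏ * Dᵏ * Wᵏ)
        ≡⟨ reorder₂ K₁ k N (e ^ k) Dᵏ Wᵏ ⟩
      K₁ * N * e ^ k * Wᵏ * (Dᵏ * suc k * (Dᵏ * suc k))
        ≤⟨ *-monoʳ-≤ (K₁ * N * e ^ k * Wᵏ) (*-mono-≤ linear linear) ⟩
      K₁ * N * e ^ k * Wᵏ * (D * Eᵏ * (D * Eᵏ))
        ≡⟨ reorder₃ K₁ N (e ^ k) Wᵏ D Eᵏ ⟩
      K₁ * (D * D) * N * (e ^ k * (Eᵏ * Eᵏ) * Wᵏ)
        ≤⟨ *-monoʳ-≤ (K₂ * N) ratioᵏ ⟩
      K₂ * N * (V ^ k * (Gᵏ * (Dᵏ * Dᵏ)))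
        ≡⟨ *-assoc (K₂ * N) (V ^ k) _ ⟨
      K₂ * N * V ^ k * (Gᵏ * (Dᵏ * Dᵏ)) ∎)
      where
      open ≤-Reasoning
      D  = 2 * g
      Gᵏ = g ^ k
      Dᵏ = D ^ k
      Eᵏ = suc D ^ k
      Wᵏ = suc V ^ k
      linear : Dᵏ * suc k ≤ D * Eᵏ
      linear = ≤-trans (*-monoʳ-≤ Dᵏ (+-monoˡ-≤ k (s≤s z≤n))) (bernoulli D k)
      ratioᵏ : e ^ k * (Eᵏ * Eᵏ) * Wᵏ ≤ V ^ k * (Gᵏ * (Dᵏ * Dᵏ))
      ratioᵏ = begin
        e ^ k * (Eᵏ * Eᵏ) * Wᵏ
          ≡⟨ cong (λ z → e ^ k * z * Wᵏ) (^-distribʳ-* k (suc D) (suc D)) ⟨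
        e ^ k * (suc D * suc D) ^ k * Wᵏ
          ≡⟨ cong (_* Wᵏ) (^-distribʳ-* k e (suc D * suc D)) ⟨
        (e * (suc D * suc D)) ^ k * Wᵏ
          ≡⟨ ^-distribʳ-* k (e * (suc D * suc D)) (suc V) ⟨
        (e * (suc D * suc D) * suc V) ^ k
          ≤⟨ ^-monoˡ-≤ k ratio ⟩
        (V * (g * (D * D))) ^ k
          ≡⟨ ^-distribʳ-* k V (g * (D * D)) ⟩
        V ^ k * (g * (D * D)) ^ k
          ≡⟨ cong (V ^ k *_) (trans (^-distribʳ-* k g (D * D)) (cong (Gᵏ *_) (^-distribʳ-* k D D))) ⟩
        V ^ k * (Gᵏ * (Dᵏ * Dᵏ)) ∎
      reorder₁ : ∀ c w x d → c * w * (x * (d * d)) ≡ c * x * (d * d * w)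
      reorder₁ = solve-∀
      reorder₂ : ∀ c k N x d w → c * (suc k * suc k) * N * x * (d * d * w) ≡ c * N * x * w * (d * suc k * (d * suc k))
      reorder₂ = solve-∀
      reorder₃ : ∀ c N x w d y → c * N * x * w * (d * y * (d * y)) ≡ c * (d * d) * N * (x * (y * y) * w)
      reorder₃ = solve-∀

    -- The least N for which the parameter k + 1 is used; it is positive, so Y ≥ 2. Since `A` = B +
    -- 1, a factor g^((k+1)^2) is left beside Y^r = g^(B (k+1)^2), and it exceeds the 2^(k+1)
    -- required by `large`.
    threshold : ℕ → ℕ
    threshold k = g ^ (A * (suc k * suc k))

    count-bound : (g≥2 : 2 ≤ g) (a : Digit g) → 1 ≤ toℕ a → ∀ N → threshold 0 ≤ N →
      ∃ λ k → N < threshold (suc k) ×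
              count (compositeMissing? g g≥2 a) N * suc V ^ suc k ≤ K₂ * N * V ^ suc k
    count-bound g≥2 a 1≤a N N≥ with bracket threshold N N N≥ N<thr
      where
      N<thr : N < threshold N
      N<thr = ≤-trans (n<2^n N) (≤-trans (^-monoˡ-≤ N g≥2) (^-monoʳ-≤ g
        (≤-trans (n≤1+n N) (≤-trans (m≤m*n (suc N) (suc N)) (m≤n*m (suc N * suc N) A)))))
    ... | k , thr≤N , N<thr = k , N<thr , absorb-log
      (count (compositeMissing? g g≥2 a) N) N (suc k) (≤-trans (count-bound-log g≥2 a 1≤a (suc k) N ℓ (s≤s z≤n) large N<2^ℓ)
      (*-monoˡ-≤ (e ^ suc k) (*-monoˡ-≤ N coeff)))
      where
      open ≤-Reasoning
      q = A * (suc (suc k) * suc (suc k))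
      -- N < g^q and g ≤ 2^g give N < 2^(g q), a logarithm of N of order (k + 2)^2.
      ℓ = g * q
      N<2^ℓ : N < 2 ^ ℓ
      N<2^ℓ = ≤-trans N<thr (≤-trans (^-monoˡ-≤ q (<⇒≤ (n<2^n g))) (≤-reflexive (^-*-assoc 2 g q)))
      large : g ^ (B * (suc k * suc k)) * 2 ^ suc k ≤ N
      large = begin
        g ^ (B * (suc k * suc k)) * 2 ^ suc k
          ≤⟨ *-monoʳ-≤ (g ^ (B * (suc k * suc k))) (≤-trans (^-monoˡ-≤ (suc k) g≥2) (^-monoʳ-≤ g (m≤m*n (suc k) (suc k)))) ⟩
        g ^ (B * (suc k * suc k)) * g ^ (suc k * suc k)
          ≡⟨ ^-distribˡ-+-* g (B * (suc k * suc k)) (suc k * suc k) ⟨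
        g ^ (B * (suc k * suc k) + suc k * suc k)
          ≡⟨ cong (g ^_) (+-comm (B * (suc k * suc k)) (suc k * suc k)) ⟩
        g ^ (A * (suc k * suc k))
          ≤⟨ thr≤N ⟩
        N ∎
      coeff : 2 + ℓ + 3 * suc g * ℓ ≤ K₁ * (suc (suc k) * suc (suc k))
      coeff = begin
        2 + ℓ + 3 * suc g * ℓ      ≤⟨ +-monoˡ-≤ _ (+-monoˡ-≤ ℓ (*-monoʳ-≤ 2 1≤ℓ)) ⟩
        2 * ℓ + ℓ + 3 * suc g * ℓ  ≡⟨ collect ℓ g ⟩
        (6 + 3 * g) * (g * (A * (suc (suc k) * suc (suc k))))
          ≡⟨ reorder (6 + 3 * g) g A (suc (suc k) * suc (suc k)) ⟩
        K₁ * (suc (suc k) * suc (suc k)) ∎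
        where
        1≤ℓ : 1 ≤ ℓ
        1≤ℓ = s≤s z≤n
        collect : ∀ ℓ g → 2 * ℓ + ℓ + 3 * suc g * ℓ ≡ (6 + 3 * g) * ℓ
        collect = solve-∀
        reorder : ∀ x g A y → x * (g * (A * y)) ≡ x * (g * A) * y
        reorder = solve-∀

module Analysis where

  open CauchyLemmas
  open Arithmetic using (module CountBound)
  import Data.Nat as ℕ
  open import Data.Nat using (ℕ; zero; suc)
  import Data.Nat.Properties as ℕ
  open import Data.Nat.Tactic.RingSolver using (solve-∀)
  open import Data.Rational using (ℚ; 0ℚ; 1ℚ; ½; ∣_∣; _+_; _*_; _-_; -_; _≤_; _<_; positive)
  open import Data.Rational.Properties
  open import Data.Rational.Solver using (module +-*-Solver)
  open import Function using (_∘_)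

  p≤∣p∣ : ∀ p → p ≤ ∣ p ∣
  p≤∣p∣ p with ≤-total 0ℚ p
  ... | inj₁ 0≤p = ≤-reflexive (sym (0≤p⇒∣p∣≡p 0≤p))
  ... | inj₂ p≤0 = ≤-trans p≤0 (0≤∣p∣ p)

  -- Products of partial sums of the exponential series

  partialSum : (ℕ → ℚ) → ℕ → ℚ
  partialSum f zero    = 0ℚ
  partialSum f (suc n) = partialSum f n + f n

  expSum≡ : ∀ q n → expSum q n ≡ partialSum (expTerm q) n
  expSum≡ q zero    = refl
  expSum≡ q (suc n) = cong (_+ expTerm q n) (expSum≡ q n)

  -- convolve f H n = Σ_{i < n} f i * H (n - i)
  convolve : (ℕ → ℚ) → (ℕ → ℚ) → ℕ → ℚ
  convolve f H zero    = 0ℚ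
  convolve f H (suc n) = f 0 * H (suc n) + convolve (f ∘ suc) H n

  -- cauchyTerm f h n = Σ_{i + j = n} f i * h j
  cauchyTerm : (ℕ → ℚ) → (ℕ → ℚ) → ℕ → ℚ
  cauchyTerm f h zero    = f 0 * h 0
  cauchyTerm f h (suc n) = f 0 * h (suc n) + cauchyTerm (f ∘ suc) h n

  module _ where
    open +-*-Solver

    convolve₀-ring : ∀ f h → f * (0ℚ + h) + 0ℚ ≡ 0ℚ + f * h
    convolve₀-ring = solve 2 (λ f h → f :* (con 0ℚ :+ h) :+ con 0ℚ := con 0ℚ :+ f :* h) refl

    convolve₁-ring : ∀ f H h x y → f * (H + h) + (x + y) ≡ f * H + x + (f * h + y)
    convolve₁-ring = solve 5 (λ f H h x y → f :* (H :+ h) :+ (x :+ y) := f :* H :+ x :+ (f :* h :+ y)) refl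

    cauchy₀-ring : ∀ i f₀ f₁ h₀ h₁ → (1ℚ + i) * (f₀ * h₁ + f₁ * h₀) ≡
      i * (f₀ * h₁) + (f₀ * (1ℚ * h₁) + (1ℚ + i) * f₁ * h₀)
    cauchy₀-ring = solve 5 (λ i f₀ f₁ h₀ h₁ → (con 1ℚ :+ i) :* (f₀ :* h₁ :+ f₁ :* h₀) :=
      i :* (f₀ :* h₁) :+ (f₀ :* (con 1ℚ :* h₁) :+ (con 1ℚ :+ i) :* f₁ :* h₀)) refl

    cauchy₀-ring′ : ∀ a b f₀ h₀ x → x + (f₀ * (b * h₀) + a * f₀ * h₀) ≡ x + (a + b) * (f₀ * h₀)
    cauchy₀-ring′ = solve 5 (λ a b f₀ h₀ x → x :+ (f₀ :* (b :* h₀) :+ a :* f₀ :* h₀) := x :+ (a :+ b) :* (f₀ :* h₀)) refl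

    cauchy₁-ring : ∀ i j f h c → (i + j) * (f * h + c) ≡ i * (f * h) + (f * (j * h) + (i + j) * c)
    cauchy₁-ring = solve 5 (λ i j f h c → (i :+ j) :* (f :* h :+ c) := i :* (f :* h) :+ (f :* (j :* h) :+ (i :+ j) :* c)) refl

    cauchy₁-ring′ : ∀ a b f h c x → x + (f * (b * h) + (a * f * h + (a + b) * c)) ≡ x + (a + b) * (f * h + c)
    cauchy₁-ring′ = solve 6 (λ a b f h c x → x :+ (f :* (b :* h) :+ (a :* f :* h :+ (a :+ b) :* c)) := x :+ (a :+ b) :* (f :* h :+ c)) refl

    error-ring : ∀ f x H z c → (f + x) * z - (f * H + c) ≡ f * (z - H) + (x * z - c)
    error-ring = solve 5 (λ f x H z c → (f :+ x) :* z :- (f :* H :+ c) := f :* (z :- H) :+ (x :* z :- c)) refl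

    zero-error-ring : ∀ z → 0ℚ * z - 0ℚ ≡ 0ℚ
    zero-error-ring = solve 1 (λ z → con 0ℚ :* z :- con 0ℚ := con 0ℚ) refl

    solve-linear-ring : ∀ i r x → i * r * x ≡ i * x * r
    solve-linear-ring = solve 3 (λ i r x → i :* r :* x := i :* x :* r) refl

  -- For H a partial sum of h, `convolve` adds f i * h j over the triangle i + j < n; the next
  -- triangle has the antidiagonal i + j = n in addition.
  convolve-suc : ∀ f h n → convolve f (partialSum h) (suc n) ≡ convolve f (partialSum h) n + cauchyTerm f h n
  convolve-suc f h zero    = convolve₀-ring (f 0) (h 0)
  convolve-suc f h (suc n) = trans
    (cong (f 0 * (partialSum h (suc n) + h (suc n)) +_) (convolve-suc (f ∘ suc) h n))
    (convolve₁-ring (f 0) (partialSum h (suc n)) (h (suc n)) (convolve (f ∘ suc) (partialSum h) n) (cauchyTerm (f ∘ suc) h n))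

  ι-+ : ∀ m n → ι (m ℕ.+ n) ≡ ι m + ι n
  ι-+ = Exp.ι-+ 0

  ι-one : ι 1 ≡ 1ℚ
  ι-one = trans (ι-suc 0) (trans (cong (1ℚ +_) ι-zero) (+-identityʳ 1ℚ))

  -- Leibniz rule: both sides are Σ_{i + j = n + 1} (k + i + j) f i * h j.
  -- The offset k appears because the induction shifts f.
  cauchyTerm-suc : ∀ a b k (f h : ℕ → ℚ) →
    (∀ i → ι (suc (k ℕ.+ i)) * f (suc i) ≡ a * f i) →
    (∀ j → ι (suc j) * h (suc j) ≡ b * h j) →
    ∀ n → ι (suc (k ℕ.+ n)) * cauchyTerm f h (suc n) ≡ ι k * (f 0 * h (suc n)) + (a + b) * cauchyTerm f h n
  cauchyTerm-suc a b k f h f′ h′ zero = begin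
    ι (suc (k ℕ.+ 0)) * (f 0 * h 1 + f 1 * h 0)
      ≡⟨ cong (_* (f 0 * h 1 + f 1 * h 0)) (ιk) ⟩
    (1ℚ + ι k) * (f 0 * h 1 + f 1 * h 0)
      ≡⟨ cauchy₀-ring (ι k) (f 0) (f 1) (h 0) (h 1) ⟩
    ι k * (f 0 * h 1) + (f 0 * (1ℚ * h 1) + (1ℚ + ι k) * f 1 * h 0)
      ≡⟨ cong₂ (λ y z → ι k * (f 0 * h 1) + (f 0 * y + z * h 0))
           (trans (cong (_* h 1) (sym ι-one)) (h′ 0)) (trans (cong (_* f 1) (sym ιk)) (f′ 0)) ⟩
    ι k * (f 0 * h 1) + (f 0 * (b * h 0) + a * f 0 * h 0)
      ≡⟨ cauchy₀-ring′ a b (f 0) (h 0) (ι k * (f 0 * h 1)) ⟩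
    ι k * (f 0 * h 1) + (a + b) * (f 0 * h 0) ∎
    where
    open ≡-Reasoning
    ιk : ι (suc (k ℕ.+ 0)) ≡ 1ℚ + ι k
    ιk = trans (cong (ι ∘ suc) (ℕ.+-identityʳ k)) (ι-suc k)
  cauchyTerm-suc a b k f h f′ h′ (suc n) = begin
    ι (suc (k ℕ.+ suc n)) * (f 0 * h (2 ℕ.+ n) + C)
      ≡⟨ cong (_* (f 0 * h (2 ℕ.+ n) + C)) split ⟩
    (ι k + ι (2 ℕ.+ n)) * (f 0 * h (2 ℕ.+ n) + C)
      ≡⟨ cauchy₁-ring (ι k) (ι (2 ℕ.+ n)) (f 0) (h (2 ℕ.+ n)) C ⟩
    ι k * (f 0 * h (2 ℕ.+ n)) + (f 0 * (ι (2 ℕ.+ n) * h (2 ℕ.+ n)) + (ι k + ι (2 ℕ.+ n)) * C)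
      ≡⟨ cong₂ (λ y z → ι k * (f 0 * h (2 ℕ.+ n)) + (f 0 * y + z)) (h′ (suc n)) inner ⟩
    ι k * (f 0 * h (2 ℕ.+ n)) + (f 0 * (b * h (suc n)) + (a * f 0 * h (suc n) + (a + b) * cauchyTerm (f ∘ suc) h n))
      ≡⟨ cauchy₁-ring′ a b (f 0) (h (suc n)) (cauchyTerm (f ∘ suc) h n) (ι k * (f 0 * h (2 ℕ.+ n))) ⟩
    ι k * (f 0 * h (2 ℕ.+ n)) + (a + b) * (f 0 * h (suc n) + cauchyTerm (f ∘ suc) h n) ∎
    where
    open ≡-Reasoning
    C = cauchyTerm (f ∘ suc) h (suc n)
    split : ι (suc (k ℕ.+ suc n)) ≡ ι k + ι (2 ℕ.+ n)
    split = trans (cong ι (sym (ℕ.+-suc k (suc n)))) (ι-+ k (2 ℕ.+ n))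
    inner : (ι k + ι (2 ℕ.+ n)) * C ≡ a * f 0 * h (suc n) + (a + b) * cauchyTerm (f ∘ suc) h n
    inner = begin
      (ι k + ι (2 ℕ.+ n)) * C
        ≡⟨ cong (_* C) (trans (sym split) (cong (ι ∘ suc) (ℕ.+-suc k n))) ⟩
      ι (suc (suc k ℕ.+ n)) * C
        ≡⟨ cauchyTerm-suc a b (suc k) (f ∘ suc) h
             (λ i → trans (cong (λ z → ι (suc z) * f (2 ℕ.+ i)) (sym (ℕ.+-suc k i))) (f′ (suc i))) h′ n ⟩
      ι (suc k) * (f 1 * h (suc n)) + (a + b) * cauchyTerm (f ∘ suc) h n
        ≡⟨ cong (_+ (a + b) * cauchyTerm (f ∘ suc) h n) (trans (sym (*-assoc (ι (suc k)) (f 1) (h (suc n))))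
             (cong (_* h (suc n)) (trans (cong (λ z → ι (suc z) * f 1) (sym (ℕ.+-identityʳ k))) (f′ 0)))) ⟩
      a * f 0 * h (suc n) + (a + b) * cauchyTerm (f ∘ suc) h n ∎

  expTerm-suc : ∀ q j → ι (suc j) * expTerm q (suc j) ≡ q * expTerm q j
  expTerm-suc q j = begin
    ι (suc j) * (expTerm q j * q * recip j)  ≡⟨ ring7 (ι (suc j)) (expTerm q j * q) (recip j) ⟩
    ι (suc j) * recip j * (expTerm q j * q)  ≡⟨ cong (_* (expTerm q j * q)) (ι*recip j) ⟩
    1ℚ * (expTerm q j * q)                   ≡⟨ *-identityˡ _ ⟩
    expTerm q j * q                          ≡⟨ *-comm (expTerm q j) q ⟩
    q * expTerm q j                          ∎
    where open ≡-Reasoning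

  -- The binomial theorem without binomial coefficients: both sides start at 1 and satisfy (n + 1)
  -- x_(n+1) = (a + b) x_n.
  cauchyTerm-expTerm : ∀ a b n → cauchyTerm (expTerm a) (expTerm b) n ≡ expTerm (a + b) n
  cauchyTerm-expTerm a b zero    = *-identityˡ 1ℚ
  cauchyTerm-expTerm a b (suc n) = begin
    X                                       ≡⟨ *-identityˡ X ⟨
    1ℚ * X                                  ≡⟨ cong (_* X) (ι*recip n) ⟨
    ι (suc n) * recip n * X                 ≡⟨ solve-linear-ring (ι (suc n)) (recip n) X ⟩
    ι (suc n) * X * recip n                 ≡⟨ cong (_* recip n) (cauchyTerm-suc a b 0 (expTerm a) (expTerm b)
                                                 (expTerm-suc a) (expTerm-suc b) n) ⟩
    (ι 0 * (1ℚ * expTerm b (suc n)) + (a + b) * Y) * recip n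
      ≡⟨ cong (λ z → (z + (a + b) * Y) * recip n) (trans (cong (_* (1ℚ * expTerm b (suc n))) ι-zero) (*-zeroˡ (1ℚ * expTerm b (suc n)))) ⟩
    (0ℚ + (a + b) * Y) * recip n            ≡⟨ cong (_* recip n) (+-identityˡ ((a + b) * Y)) ⟩
    (a + b) * Y * recip n                   ≡⟨ cong (_* recip n) (trans (*-comm (a + b) Y)
                                                 (cong (_* (a + b)) (cauchyTerm-expTerm a b n))) ⟩
    expTerm (a + b) n * (a + b) * recip n   ∎
    where
    open ≡-Reasoning
    X = cauchyTerm (expTerm a) (expTerm b) (suc n)
    Y = cauchyTerm (expTerm a) (expTerm b) n

  convolve-exp : ∀ a b n → convolve (expTerm a) (partialSum (expTerm b)) n ≡ expSum (a + b) n
  convolve-exp a b zero    = refl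
  convolve-exp a b (suc n) = trans (convolve-suc (expTerm a) (expTerm b) n)
    (cong₂ _+_ (convolve-exp a b n) (cauchyTerm-expTerm a b n))

  partialSum-suc : ∀ f n → partialSum f (suc n) ≡ f 0 + partialSum (f ∘ suc) n
  partialSum-suc f zero    = trans (+-identityˡ (f 0)) (sym (+-identityʳ (f 0)))
  partialSum-suc f (suc n) = trans (cong (_+ f (suc n)) (partialSum-suc f n))
    (+-assoc (f 0) (partialSum (f ∘ suc) n) (f (suc n)))

  -- The difference equals the sum over i < n of f i * (H z - H (n - i)), so majorants of f and of
  -- the increments of H bound it term by term.
  convolve-error : ∀ {f F H G : ℕ → ℚ} {z} → (∀ i → ∣ f i ∣ ≤ F i) →
    (∀ m → m ℕ.≤ z → ∣ H z - H m ∣ ≤ G z - G m) →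
    ∀ n → n ℕ.≤ z → ∣ partialSum f n * H z - convolve f H n ∣ ≤ partialSum F n * G z - convolve F G n
  convolve-error {H = H} {G} {z} f≤F H≤G zero    _   =
    ≤-reflexive (trans (cong ∣_∣ (zero-error-ring (H z))) (sym (zero-error-ring (G z))))
  convolve-error {f} {F} {H} {G} {z} f≤F H≤G (suc n) n<z = begin
    ∣ partialSum f (suc n) * H z - convolve f H (suc n) ∣
      ≡⟨ cong ∣_∣ (trans (cong (λ y → y * H z - convolve f H (suc n)) (partialSum-suc f n))
           (error-ring (f 0) (partialSum (f ∘ suc) n) (H (suc n)) (H z) (convolve (f ∘ suc) H n))) ⟩
    ∣ f 0 * (H z - H (suc n)) + R ∣
      ≤⟨ ∣p+q∣≤∣p∣+∣q∣ (f 0 * (H z - H (suc n))) R ⟩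
    ∣ f 0 * (H z - H (suc n)) ∣ + ∣ R ∣
      ≡⟨ cong (_+ ∣ R ∣) (∣p*q∣≡∣p∣*∣q∣ (f 0) (H z - H (suc n))) ⟩
    ∣ f 0 ∣ * ∣ H z - H (suc n) ∣ + ∣ R ∣
      ≤⟨ +-mono-≤ (*-mono (0≤∣p∣ (H z - H (suc n))) (≤-trans (0≤∣p∣ (f 0)) (f≤F 0)) (f≤F 0) (H≤G (suc n) n<z))
           (convolve-error (λ i → f≤F (suc i)) H≤G n (ℕ.<⇒≤ n<z)) ⟩
    F 0 * (G z - G (suc n)) + (partialSum (F ∘ suc) n * G z - convolve (F ∘ suc) G n)
      ≡⟨ trans (cong (λ y → y * G z - convolve F G (suc n)) (partialSum-suc F n))
           (error-ring (F 0) (partialSum (F ∘ suc) n) (G (suc n)) (G z) (convolve (F ∘ suc) G n)) ⟨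
    partialSum F (suc n) * G z - convolve F G (suc n) ∎
    where
    open ≤-Reasoning
    R = partialSum (f ∘ suc) n * H z - convolve (f ∘ suc) H n

  -- The rectangle i < n, j < m lies in the triangle i + j < n + m.
  square≤triangle : ∀ {F G : ℕ → ℚ} → (∀ i → 0ℚ ≤ F i) → (∀ i → 0ℚ ≤ G i) → (∀ {i j} → i ℕ.≤ j → G i ≤ G j) →
    ∀ n m → partialSum F n * G m ≤ convolve F G (n ℕ.+ m)
  square≤triangle {F} {G} F≥0 G≥0 G-mono zero m = ≤-trans (≤-reflexive (*-zeroˡ (G m))) (convolve≥0 F≥0 m)
    where
    convolve≥0 : ∀ {F} → (∀ i → 0ℚ ≤ F i) → ∀ n → 0ℚ ≤ convolve F G n
    convolve≥0 F≥0 zero    = ≤-refl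
    convolve≥0 F≥0 (suc n) = +-mono-≤ (*-nonNeg (F≥0 0) (G≥0 (suc n))) (convolve≥0 (λ i → F≥0 (suc i)) n)
  square≤triangle {F} {G} F≥0 G≥0 G-mono (suc n) m = begin
    partialSum F (suc n) * G m                    ≡⟨ cong (_* G m) (partialSum-suc F n) ⟩
    (F 0 + partialSum (F ∘ suc) n) * G m          ≡⟨ *-distribʳ-+ (G m) (F 0) (partialSum (F ∘ suc) n) ⟩
    F 0 * G m + partialSum (F ∘ suc) n * G m      ≤⟨ +-mono-≤ (*-monoˡ (F≥0 0) (G-mono (ℕ.m≤n+m m (suc n))))
                                                       (square≤triangle (λ i → F≥0 (suc i)) G≥0 G-mono n m) ⟩
    F 0 * G (suc n ℕ.+ m) + convolve (F ∘ suc) G (n ℕ.+ m) ∎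
    where open ≤-Reasoning

  module ExpProduct (μ : ℕ) where
    open Exp μ using (M; t; E; t≥0; term-bound)
    open ≤-Reasoning

    P : ℕ → ℚ
    P = partialSum t

    P-suc : ∀ n → P n ≤ P (suc n)
    P-suc n = ≤-trans (≤-reflexive (sym (+-identityʳ (P n)))) (+-monoʳ-≤ (P n) (t≥0 n))

    P≥0 : ∀ n → 0ℚ ≤ P n
    P≥0 zero    = ≤-refl
    P≥0 (suc n) = ≤-trans (P≥0 n) (P-suc n)

    P-shift : ∀ i j → P i ≤ P (j ℕ.+ i)
    P-shift i zero    = ≤-refl
    P-shift i (suc j) = ≤-trans (P-shift i j) (P-suc (j ℕ.+ i))

    P-mono : ∀ {i j} → i ℕ.≤ j → P i ≤ P j
    P-mono {i} {j} i≤j = subst (λ z → P i ≤ P z) (ℕ.m∸n+n≡m i≤j) (P-shift i (j ℕ.∸ i))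

    partialSum-error : ∀ {b} → ∣ b ∣ ≤ M → ∀ z m → m ℕ.≤ z →
      ∣ partialSum (expTerm b) z - partialSum (expTerm b) m ∣ ≤ P z - P m
    partialSum-error {b} b≤M z m m≤z = subst (λ w → ∣ B w - B m ∣ ≤ P w - P m) (ℕ.m∸n+n≡m m≤z) (go (z ℕ.∸ m))
      where
      B = partialSum (expTerm b)
      go : ∀ j → ∣ B (j ℕ.+ m) - B m ∣ ≤ P (j ℕ.+ m) - P m
      go j = subst₂ (λ x y → ∣ x - B m ∣ ≤ y - P m) (expSum≡ b (j ℕ.+ m)) (expSum≡ M (j ℕ.+ m))
        (subst₂ (λ x y → ∣ expSum b (j ℕ.+ m) - x ∣ ≤ E (j ℕ.+ m) - y) (expSum≡ b m) (expSum≡ M m) (Exp.tail≤ μ b≤M m j))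

    -- The terms of the square of side n outside the triangle of side n lie in the triangle of side
    -- 2n. For the majorant M they are bounded by a stretch of the exponential series at M + M.
    product-error : ∀ {a b} → ∣ a ∣ ≤ M → ∣ b ∣ ≤ M → ∀ n →
      ∣ expSum a n * expSum b n - expSum (a + b) n ∣ ≤ expSum (M + M) (n ℕ.+ n) - expSum (M + M) n
    product-error {a} {b} a≤M b≤M n = begin
      ∣ expSum a n * expSum b n - expSum (a + b) n ∣
        ≡⟨ cong₂ (λ x y → ∣ x - y ∣) (cong₂ _*_ (expSum≡ a n) (expSum≡ b n)) (sym (convolve-exp a b n)) ⟩
      ∣ partialSum (expTerm a) n * partialSum (expTerm b) n - convolve (expTerm a) (partialSum (expTerm b)) n ∣
        ≤⟨ convolve-error (term-bound a≤M) (partialSum-error b≤M n) n ℕ.≤-refl ⟩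
      P n * P n - convolve t P n
        ≤⟨ +-monoˡ-≤ (- convolve t P n) (square≤triangle t≥0 P≥0 P-mono n n) ⟩
      convolve t P (n ℕ.+ n) - convolve t P n
        ≡⟨ cong₂ _-_ (convolve-exp M M (n ℕ.+ n)) (convolve-exp M M n) ⟩
      expSum (M + M) (n ℕ.+ n) - expSum (M + M) n ∎

    -- N is found before a and b. This uniformity is essential, since the rational arguments used
    -- later change with the stage n.
    product-uniform : ∀ ε → 0ℚ < ε → ∃ λ N → ∀ n → N ℕ.≤ n → ∀ {a b} → ∣ a ∣ ≤ M → ∣ b ∣ ≤ M →
      expSum a n * expSum b n ≤ expSum (a + b) n + ε
    product-uniform ε ε>0 with exp-cauchy {λ _ → M + M} (const-cauchy (M + M)) ε ε>0
    ... | N , close = N , λ n N≤n {a} {b} a≤M b≤M → begin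
      expSum a n * expSum b n
        ≡⟨ ring4 (expSum a n * expSum b n) (expSum (a + b) n) ⟩
      expSum a n * expSum b n - expSum (a + b) n + expSum (a + b) n
        ≤⟨ +-monoˡ-≤ (expSum (a + b) n) (begin
             expSum a n * expSum b n - expSum (a + b) n       ≤⟨ p≤∣p∣ _ ⟩
             ∣ expSum a n * expSum b n - expSum (a + b) n ∣   ≤⟨ product-error a≤M b≤M n ⟩
             expSum (M + M) (n ℕ.+ n) - expSum (M + M) n      ≤⟨ p≤∣p∣ _ ⟩
             ∣ expSum (M + M) (n ℕ.+ n) - expSum (M + M) n ∣  ≤⟨ close (n ℕ.+ n) n (ℕ.≤-trans N≤n (ℕ.m≤m+n n n)) N≤n ⟩
             ε ∎) ⟩
      ε + expSum (a + b) n
        ≡⟨ +-comm ε (expSum (a + b) n) ⟩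
      expSum (a + b) n + ε ∎

  -- Lower bounds for exp by powers and by single terms

  module _ where
    open +-*-Solver

    ring15 : ∀ p q r → p - r ≡ p - q - r + q
    ring15 = solve 3 (λ p q r → p :- r := p :- q :- r :+ q) refl

    ring16 : ∀ i u → (1ℚ + i) * u ≡ i * u + u
    ring16 = solve 2 (λ i u → (con 1ℚ :+ i) :* u := i :* u :+ u) refl

    ring17 : ∀ v r → v * r + r ≡ (1ℚ + v) * r
    ring17 = solve 2 (λ v r → v :* r :+ r := (con 1ℚ :+ v) :* r) refl

    ring18 : ∀ a b i j → a * b * (i * j) ≡ a * i * (b * j)
    ring18 = solve 4 (λ a b i j → a :* b :* (i :* j) := a :* i :* (b :* j)) refl

    ring19 : ∀ q r d j s → q * r * (d * j) * s ≡ q * (d * r) * (j * s)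
    ring19 = solve 5 (λ q r d j s → q :* r :* (d :* j) :* s := q :* (d :* r) :* (j :* s)) refl

    ring20 : ∀ k x e → k * ((x + x) * e) ≡ (k + k) * (x * e)
    ring20 = solve 3 (λ k x e → k :* ((x :+ x) :* e) := (k :+ k) :* (x :* e)) refl

    ring21 : ∀ a b c → a * (b * c) ≡ b * (a * c)
    ring21 = solve 3 (λ a b c → a :* (b :* c) := b :* (a :* c)) refl

    ring22 : ∀ x → x + ½ + (x + ½) ≡ x + x + 1ℚ
    ring22 = solve 1 (λ x → x :+ con ½ :+ (x :+ con ½) := x :+ x :+ con 1ℚ) refl

    ring23 : ∀ v r w → v * r * w ≡ v * (w * r)
    ring23 = solve 3 (λ v r w → v :* r :* w := v :* (w :* r)) refl

  <⇒≱ : ∀ {p q} → p < q → ¬ q ≤ p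
  <⇒≱ p<q q≤p = <-irrefl refl (<-≤-trans p<q q≤p)

  +-cancelʳ-≤ : ∀ r p q → p + r ≤ q + r → p ≤ q
  +-cancelʳ-≤ r p q h = subst₂ _≤_ (cancel p) (cancel q) (+-monoˡ-≤ (- r) h)
    where
    cancel : ∀ p → p + r - r ≡ p
    cancel p = trans (cong (_- r) (+-comm p r)) (ring13 r p)

  *-pos : ∀ {p q} → 0ℚ < p → 0ℚ < q → 0ℚ < p * q
  *-pos {p} {q} p>0 q>0 = subst (_< p * q) (*-zeroˡ q) (*-monoˡ-<-pos q {{positive q>0}} p>0)

  -ʳ-swap : ∀ p q r → p - q ≤ r → p - r ≤ q
  -ʳ-swap p q r p-q≤r = begin
    p - r          ≡⟨ ring15 p q r ⟩
    p - q - r + q  ≤⟨ +-monoˡ-≤ q (+-monoˡ-≤ (- r) p-q≤r) ⟩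
    r - r + q      ≡⟨ cong (_+ q) (+-inverseʳ r) ⟩
    0ℚ + q         ≡⟨ +-identityˡ q ⟩
    q              ∎
    where open ≤-Reasoning

  ι-* : ∀ m n → ι (m ℕ.* n) ≡ ι m * ι n
  ι-* zero    n = trans ι-zero (sym (trans (cong (_* ι n) ι-zero) (*-zeroˡ (ι n))))
  ι-* (suc m) n = begin
    ι (n ℕ.+ m ℕ.* n)   ≡⟨ ι-+ n (m ℕ.* n) ⟩
    ι n + ι (m ℕ.* n)   ≡⟨ cong (ι n +_) (ι-* m n) ⟩
    ι n + ι m * ι n     ≡⟨ +-comm (ι n) (ι m * ι n) ⟩
    ι m * ι n + ι n     ≡⟨ ring17 (ι m) (ι n) ⟩
    (1ℚ + ι m) * ι n    ≡⟨ cong (_* ι n) (ι-suc m) ⟨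
    ι (suc m) * ι n     ∎
    where open ≡-Reasoning

  1≤ι : ∀ {n} → 1 ℕ.≤ n → 1ℚ ≤ ι n
  1≤ι {n} 1≤n = subst (_≤ ι n) ι-one (ι-mono 1≤n)

  ι-cancel-< : ∀ {m n} → ι m < ι n → m ℕ.< n
  ι-cancel-< {m} {n} ιm<ιn with m ℕ.<? n
  ... | yes m<n = m<n
  ... | no  m≮n = contradiction (ι-mono (ℕ.≮⇒≥ m≮n)) (<⇒≱ ιm<ιn)

  expSum-0 : ∀ n → expSum 0ℚ (suc n) ≡ 1ℚ
  expSum-0 zero    = refl
  expSum-0 (suc n) = trans (cong₂ _+_ (expSum-0 n)
    (trans (cong (_* recip n) (*-zeroʳ (expTerm 0ℚ n))) (*-zeroˡ (recip n)))) (+-identityʳ 1ℚ)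

  -- β bounds the Lipschitz constants of all partial sums on [-1, 1]. For μ = 1 the uniform bound on
  -- these constants starts at n = `K` = 2.
  expSum-near-0 : ∃ λ β → ∀ {u} → ∣ u ∣ ≤ 1ℚ → ∀ n → 2 ℕ.≤ n → 1ℚ - ∣ u ∣ * ι β ≤ expSum u n
  expSum-near-0 = β , near
    where
    open Exp 1 using (K; E; potential; bound; sum-lipschitz)
    open ≤-Reasoning
    β = proj₁ (bounded-by-ℕ (potential K))
    near : ∀ {u} → ∣ u ∣ ≤ 1ℚ → ∀ n → 2 ℕ.≤ n → 1ℚ - ∣ u ∣ * ι β ≤ expSum u n
    near {u} u≤1 n@(suc n-1) 2≤n = -ʳ-swap 1ℚ (expSum u n) (∣ u ∣ * ι β) (begin
      1ℚ - expSum u n                  ≡⟨ cong (_- expSum u n) (expSum-0 n-1) ⟨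
      expSum 0ℚ n - expSum u n         ≤⟨ p≤∣p∣ (expSum 0ℚ n - expSum u n) ⟩
      ∣ expSum 0ℚ n - expSum u n ∣     ≤⟨ sum-lipschitz (ι-nonNeg 1) (subst (∣ u ∣ ≤_) (sym ι-one) u≤1) n ⟩
      ∣ 0ℚ - u ∣ * E n                 ≡⟨ cong (_* E n) (trans (cong ∣_∣ (+-identityˡ (- u))) (∣-p∣≡∣p∣ u)) ⟩
      ∣ u ∣ * E n                      ≤⟨ *-monoˡ (0≤∣p∣ u) (≤-trans (bound n 2≤n) (proj₂ (bounded-by-ℕ (potential K)))) ⟩
      ∣ u ∣ * ι β                      ∎)

  pow : ℚ → ℕ → ℚ
  pow ρ zero    = 1ℚ
  pow ρ (suc k) = pow ρ k * ρ

  pow-pos : ∀ {ρ} → 0ℚ < ρ → ∀ k → 0ℚ < pow ρ k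
  pow-pos ρ>0 zero    = 0<1
  pow-pos ρ>0 (suc k) = *-pos (pow-pos ρ>0 k) ρ>0

  -- exp u > ρ + δ for small u, and exp (k u) is approximately (exp u) ^ k; the
  -- slack δ absorbs the truncation errors of the partial sums.
  exp-lower : ∀ {ρ δ} → 0ℚ < ρ → 0ℚ < δ → ρ + δ + δ ≡ 1ℚ → ∃ λ q → 0ℚ < q ×
    (∀ k → ∃ λ N → ∀ n → N ℕ.≤ n → ∀ {u} → ∣ u ∣ ≤ q → pow ρ k ≤ expSum (ι k * u) n)
  exp-lower {ρ} {δ} ρ>0 δ>0 ρ+2δ≡1 = q , q>0 , steps
    where
    open ≤-Reasoning
    β : ℕ
    β = proj₁ expSum-near-0
    small : ∃ λ q → 0ℚ < q × ι (suc β) * q ≤ δ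
    small = shrink (ι (suc β)) δ δ>0
    q : ℚ
    q = proj₁ small
    q>0 : 0ℚ < q
    q>0 = proj₁ (proj₂ small)
    δ≤1 : δ ≤ 1ℚ
    δ≤1 = begin
      δ          ≡⟨ +-identityˡ δ ⟨
      0ℚ + δ     ≤⟨ +-monoˡ-≤ δ (+-mono-≤ (<⇒≤ ρ>0) (<⇒≤ δ>0)) ⟩
      ρ + δ + δ  ≡⟨ ρ+2δ≡1 ⟩
      1ℚ         ∎
    q≤1 : q ≤ 1ℚ
    q≤1 = begin
      q              ≡⟨ *-identityˡ q ⟨
      1ℚ * q         ≤⟨ *-monoʳ (<⇒≤ q>0) (1≤ι (ℕ.s≤s ℕ.z≤n)) ⟩
      ι (suc β) * q  ≤⟨ proj₂ (proj₂ small) ⟩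
      δ              ≤⟨ δ≤1 ⟩
      1ℚ             ∎
    one : ∀ n → 2 ℕ.≤ n → ∀ u → ∣ u ∣ ≤ q → ρ + δ ≤ expSum u n
    one n 2≤n u u≤q = begin
      ρ + δ              ≡⟨ trans (sym (ring13 δ (ρ + δ))) (cong (_- δ) (+-comm δ (ρ + δ))) ⟩
      ρ + δ + δ - δ      ≡⟨ cong (_- δ) ρ+2δ≡1 ⟩
      1ℚ - δ             ≤⟨ +-monoʳ-≤ 1ℚ (neg-antimono-≤ (begin
        ∣ u ∣ * ι β        ≤⟨ *-mono (ι-nonNeg β) (<⇒≤ q>0) u≤q (ι-mono (ℕ.n≤1+n β)) ⟩
        q * ι (suc β)      ≡⟨ *-comm q (ι (suc β)) ⟩
        ι (suc β) * q      ≤⟨ proj₂ (proj₂ small) ⟩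
        δ                  ∎)) ⟩
      1ℚ - ∣ u ∣ * ι β   ≤⟨ proj₂ expSum-near-0 (≤-trans u≤q q≤1) n 2≤n ⟩
      expSum u n         ∎
    ρ+δ≥0 : 0ℚ ≤ ρ + δ
    ρ+δ≥0 = +-mono-≤ (<⇒≤ ρ>0) (<⇒≤ δ>0)
    ε>0 : ∀ k → 0ℚ < pow ρ k * δ
    ε>0 k = *-pos (pow-pos ρ>0 k) δ>0
    -- The tolerance ρ^k δ is exactly the excess of ρ^k (ρ + δ) over ρ^(k+1), so it cancels in
    -- `step`.
    product : ∀ k → ∃ λ N → ∀ n → N ℕ.≤ n → ∀ {a b} → ∣ a ∣ ≤ ι (suc k) → ∣ b ∣ ≤ ι (suc k) →
      expSum a n * expSum b n ≤ expSum (a + b) n + pow ρ k * δ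
    product k = ExpProduct.product-uniform (suc k) (pow ρ k * δ) (ε>0 k)
    ku≤ : ∀ k u → ∣ u ∣ ≤ q → ∣ ι k * u ∣ ≤ ι (suc k)
    ku≤ k u u≤q = begin
      ∣ ι k * u ∣       ≡⟨ ∣p*q∣≡∣p∣*∣q∣ (ι k) u ⟩
      ∣ ι k ∣ * ∣ u ∣   ≡⟨ cong (_* ∣ u ∣) (0≤p⇒∣p∣≡p (ι-nonNeg k)) ⟩
      ι k * ∣ u ∣       ≤⟨ *-monoˡ (ι-nonNeg k) (≤-trans u≤q q≤1) ⟩
      ι k * 1ℚ          ≡⟨ *-identityʳ (ι k) ⟩
      ι k               ≤⟨ ι-mono (ℕ.n≤1+n k) ⟩
      ι (suc k)         ∎
    step : ∀ k n u → ∣ u ∣ ≤ q → 2 ℕ.≤ n → proj₁ (product k) ℕ.≤ n →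
      pow ρ k ≤ expSum (ι k * u) n → pow ρ (suc k) ≤ expSum (ι (suc k) * u) n
    step k n u u≤q 2≤n N≤n ih = +-cancelʳ-≤ (pow ρ k * δ) (pow ρ k * ρ) (expSum (ι (suc k) * u) n) (begin
      pow ρ k * ρ + pow ρ k * δ                ≡⟨ *-distribˡ-+ (pow ρ k) ρ δ ⟨
      pow ρ k * (ρ + δ)                        ≤⟨ *-mono ρ+δ≥0 (≤-trans (<⇒≤ (pow-pos ρ>0 k)) ih) ih (one n 2≤n u u≤q) ⟩
      expSum (ι k * u) n * expSum u n          ≤⟨ proj₂ (product k) n N≤n (ku≤ k u u≤q)
                                                    (≤-trans (≤-trans u≤q q≤1) (1≤ι {suc k} (ℕ.s≤s ℕ.z≤n))) ⟩
      expSum (ι k * u + u) n + pow ρ k * δ     ≡⟨ cong (λ z → expSum z n + pow ρ k * δ)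
                                                    (trans (sym (ring16 (ι k) u)) (cong (_* u) (sym (ι-suc k)))) ⟩
      expSum (ι (suc k) * u) n + pow ρ k * δ   ∎)
    steps : ∀ k → ∃ λ N → ∀ n → N ℕ.≤ n → ∀ {u} → ∣ u ∣ ≤ q → pow ρ k ≤ expSum (ι k * u) n
    steps zero    = 1 , λ { (suc n) _ {u} _ → ≤-reflexive (sym (trans
      (cong (λ z → expSum z (suc n)) (trans (cong (_* u) ι-zero) (*-zeroˡ u))) (expSum-0 n))) }
    steps (suc k) = proj₁ (steps k) ℕ.+ (proj₁ (product k) ℕ.+ 2) , λ n N≤n {u} u≤q →
      let N≤n′ = ℕ.m+n≤o⇒n≤o (proj₁ (steps k)) N≤n in
      step k n u u≤q (ℕ.m+n≤o⇒n≤o (proj₁ (product k)) N≤n′) (ℕ.m+n≤o⇒m≤o (proj₁ (product k)) N≤n′)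
        (proj₂ (steps k) n (ℕ.m+n≤o⇒m≤o (proj₁ (steps k)) N≤n) u≤q)

  module _ {q : ℚ} (q≥0 : 0ℚ ≤ q) where

    expTerm-nonNeg : ∀ j → 0ℚ ≤ expTerm q j
    expTerm-nonNeg zero    = <⇒≤ 0<1
    expTerm-nonNeg (suc j) = *-nonNeg (*-nonNeg (expTerm-nonNeg j) q≥0) (recip-nonNeg j)

    expSum-nonNeg : ∀ n → 0ℚ ≤ expSum q n
    expSum-nonNeg zero    = ≤-refl
    expSum-nonNeg (suc n) = +-mono-≤ (expSum-nonNeg n) (expTerm-nonNeg n)

    expTerm≤expSum : ∀ {j n} → j ℕ.< n → expTerm q j ≤ expSum q n
    expTerm≤expSum {j} {suc n} (ℕ.s≤s j≤n) with ℕ.m≤n⇒m<n∨m≡n j≤n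
    ... | inj₁ j<n  = ≤-trans (≤-trans (≤-reflexive (sym (+-identityʳ _))) (+-monoʳ-≤ (expTerm q j) (expTerm-nonNeg n)))
                              (+-monoˡ-≤ (expTerm q n) (expTerm≤expSum j<n))
    ... | inj₂ refl = ≤-trans (≤-reflexive (sym (+-identityˡ _))) (+-monoˡ-≤ (expTerm q j) (expSum-nonNeg j))

  -- exp q ≥ q^E / E! ≥ b^E as soon as q ≥ b E.
  power≤expSum : ∀ b E {q} → ι (b ℕ.* E) ≤ q → ∀ {n} → E ℕ.< n → ι (b ℕ.^ E) ≤ expSum q n
  power≤expSum b E {q} bE≤q E<n = ≤-trans (terms E ℕ.≤-refl) (expTerm≤expSum q≥0 E<n)
    where
    open ≤-Reasoning
    q≥0 : 0ℚ ≤ q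
    q≥0 = ≤-trans (ι-nonNeg (b ℕ.* E)) bE≤q
    terms : ∀ j → j ℕ.≤ E → ι (b ℕ.^ j) ≤ expTerm q j
    terms zero    _   = ≤-reflexive ι-one
    terms (suc j) j<E = begin
      ι (b ℕ.* b ℕ.^ j)                        ≡⟨ trans (ι-* b (b ℕ.^ j)) (*-comm (ι b) (ι (b ℕ.^ j))) ⟩
      ι (b ℕ.^ j) * ι b                        ≡⟨ cong (ι (b ℕ.^ j) *_) b≡ ⟩
      ι (b ℕ.^ j) * (ι (b ℕ.* suc j) * recip j) ≡⟨ *-assoc (ι (b ℕ.^ j)) (ι (b ℕ.* suc j)) (recip j) ⟨
      ι (b ℕ.^ j) * ι (b ℕ.* suc j) * recip j  ≤⟨ *-monoʳ (recip-nonNeg j) (*-mono (ι-nonNeg (b ℕ.* suc j)) (expTerm-nonNeg q≥0 j)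
                                                    (terms j (ℕ.<⇒≤ j<E)) (≤-trans (ι-mono (ℕ.*-monoʳ-≤ b j<E)) bE≤q)) ⟩
      expTerm q j * q * recip j                ∎
      where
      b≡ : ι b ≡ ι (b ℕ.* suc j) * recip j
      b≡ = sym (trans (cong (_* recip j) (ι-* b (suc j))) (trans (*-assoc (ι b) (ι (suc j)) (recip j))
        (trans (cong (ι b *_) (ι*recip j)) (*-identityʳ (ι b)))))

  -- From powers of ρ to exp (- c √log x)

  module Ratio (v : ℕ) where

    open ≤-Reasoning

    private
      V W : ℕ
      V = suc v
      W = suc V

    -- `recip V` is 1 / (V + 1) = 1 / W, so ρ = V / W and δ is half of the gap 1 - ρ.
    ρ δ : ℚ
    ρ = ι V * recip V
    δ = recip V * ½

    ρ>0 : 0ℚ < ρ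
    ρ>0 = *-pos (<-≤-trans 0<1 (1≤ι {V} (ℕ.s≤s ℕ.z≤n))) (recip-pos V)

    ρ+2δ≡1 : ρ + δ + δ ≡ 1ℚ
    ρ+2δ≡1 = begin-equality
      ρ + δ + δ                ≡⟨ +-assoc ρ δ δ ⟩
      ρ + (δ + δ)              ≡⟨ cong (ρ +_) (halves (recip V)) ⟩
      ι V * recip V + recip V  ≡⟨ ring17 (ι V) (recip V) ⟩
      (1ℚ + ι V) * recip V     ≡⟨ cong (_* recip V) (ι-suc V) ⟨
      ι W * recip V            ≡⟨ ι*recip V ⟩
      1ℚ                       ∎

    ρ*W : ρ * ι W ≡ ι V
    ρ*W = trans (ring23 (ι V) (recip V) (ι W)) (trans (cong (ι V *_) (ι*recip V)) (*-identityʳ (ι V)))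

    pow-ρ : ∀ j → pow ρ j * ι (W ℕ.^ j) ≡ ι (V ℕ.^ j)
    pow-ρ zero    = *-identityˡ (ι 1)
    pow-ρ (suc j) = begin-equality
      pow ρ j * ρ * ι (W ℕ.* W ℕ.^ j)      ≡⟨ cong (pow ρ j * ρ *_) (trans (ι-* W (W ℕ.^ j)) (*-comm (ι W) (ι (W ℕ.^ j)))) ⟩
      pow ρ j * ρ * (ι (W ℕ.^ j) * ι W)    ≡⟨ ring18 (pow ρ j) ρ (ι (W ℕ.^ j)) (ι W) ⟩
      pow ρ j * ι (W ℕ.^ j) * (ρ * ι W)    ≡⟨ cong₂ _*_ (pow-ρ j) ρ*W ⟩
      ι (V ℕ.^ j) * ι V                    ≡⟨ trans (*-comm (ι (V ℕ.^ j)) (ι V)) (sym (ι-* V (V ℕ.^ j))) ⟩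
      ι (V ℕ.* V ℕ.^ j)                    ∎

    -- The count is saved by a power with exponent j, but N is bounded from above at the next
    -- threshold, which belongs to j + 1. The extra factor ρ costs at most 2, as W ≤ 2 V.
    ι-ratio : ∀ m K N j → m ℕ.* W ℕ.^ j ℕ.≤ K ℕ.* N ℕ.* V ℕ.^ j → ι m ≤ ι (2 ℕ.* K) * (ι N * pow ρ (suc j))
    ι-ratio m K N j h = *-cancelʳ-≤-pos w {{positive (<-≤-trans 0<1 (1≤ι (ℕ.m^n>0 W (suc j))))}} (begin
      ι m * w                            ≡⟨ ι-* m (W ℕ.^ suc j) ⟨
      ι (m ℕ.* W ℕ.^ suc j)              ≤⟨ ι-mono h′ ⟩
      ι (2 ℕ.* K ℕ.* (N ℕ.* V ℕ.^ suc j))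
                                         ≡⟨ trans (ι-* (2 ℕ.* K) (N ℕ.* V ℕ.^ suc j)) (cong (ι (2 ℕ.* K) *_) (ι-* N (V ℕ.^ suc j))) ⟩
      ι (2 ℕ.* K) * (ι N * ι (V ℕ.^ suc j))  ≡⟨ cong (λ z → ι (2 ℕ.* K) * (ι N * z)) (pow-ρ (suc j)) ⟨
      ι (2 ℕ.* K) * (ι N * (p * w))          ≡⟨ cong (ι (2 ℕ.* K) *_) (*-assoc (ι N) p w) ⟨
      ι (2 ℕ.* K) * (ι N * p * w)            ≡⟨ *-assoc (ι (2 ℕ.* K)) (ι N * p) w ⟨
      ι (2 ℕ.* K) * (ι N * p) * w            ∎)
      where
      w p : ℚ
      w = ι (W ℕ.^ suc j)
      p = pow ρ (suc j)
      W≤2V : W ℕ.≤ 2 ℕ.* V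
      W≤2V = ℕ.≤-trans (ℕ.+-monoˡ-≤ V (ℕ.s≤s ℕ.z≤n)) (ℕ.≤-reflexive (cong (V ℕ.+_) (sym (ℕ.+-identityʳ V))))
      reorder₁ : ∀ m w x → m ℕ.* (w ℕ.* x) ≡ w ℕ.* (m ℕ.* x)
      reorder₁ = solve-∀
      reorder₂ : ∀ v k n x → 2 ℕ.* v ℕ.* (k ℕ.* n ℕ.* x) ≡ 2 ℕ.* k ℕ.* (n ℕ.* (v ℕ.* x))
      reorder₂ = solve-∀
      h′ : m ℕ.* W ℕ.^ suc j ℕ.≤ 2 ℕ.* K ℕ.* (N ℕ.* V ℕ.^ suc j)
      h′ = subst₂ ℕ._≤_ (sym (reorder₁ m W (W ℕ.^ j))) (reorder₂ V K N (V ℕ.^ j)) (ℕ.*-mono-≤ W≤2V h)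

  -- The hypotheses are the properties of √log x at a single stage with error 1, so r may fall to
  -- -1. For r ≥ 0, r^2 ≤ l + 1 < g A J^2 + 1 ≤ (g A + 1) J^2, and squaring g A + 1 as well avoids
  -- its root.
  sqrt-bound : ∀ g A J .{{_ : ℕ.NonZero J}} → ∀ {l} r → l < ι (g ℕ.* (A ℕ.* (J ℕ.* J))) → r * r ≤ l + 1ℚ → 0ℚ ≤ r + 1ℚ →
    ∣ r ∣ ≤ ι (suc (g ℕ.* A) ℕ.* J)
  sqrt-bound g A J {l} r l< rr≤ 0≤r+1 = by-sign (∣p∣≡p∨∣p∣≡-p r)
    where
    open ≤-Reasoning
    D T : ℕ
    D = suc (g ℕ.* A)
    T = g ℕ.* (A ℕ.* (J ℕ.* J))
    1≤J : 1 ℕ.≤ J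
    1≤J = ℕ.>-nonZero⁻¹ J
    identity : ∀ g A J → suc (g ℕ.* A) ℕ.* (J ℕ.* J) ≡ J ℕ.* J ℕ.+ g ℕ.* (A ℕ.* (J ℕ.* J))
    identity = solve-∀
    regroup : ∀ D J → D ℕ.* (D ℕ.* (J ℕ.* J)) ≡ D ℕ.* J ℕ.* (D ℕ.* J)
    regroup = solve-∀
    square : suc T ℕ.≤ D ℕ.* J ℕ.* (D ℕ.* J)
    square = ℕ.≤-trans (ℕ.+-monoˡ-≤ T (ℕ.*-mono-≤ 1≤J 1≤J))
      (ℕ.≤-trans (ℕ.≤-reflexive (sym (identity g A J))) (ℕ.≤-trans (ℕ.m≤n*m (D ℕ.* (J ℕ.* J)) D)
        (ℕ.≤-reflexive (regroup D J))))
    by-sign : ∣ r ∣ ≡ r ⊎ ∣ r ∣ ≡ - r → ∣ r ∣ ≤ ι (D ℕ.* J)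
    by-sign (inj₂ ∣r∣≡-r) = begin
      ∣ r ∣              ≡⟨ ∣r∣≡-r ⟩
      - r                ≡⟨ +-identityˡ (- r) ⟨
      0ℚ - r             ≤⟨ -ʳ-swap 0ℚ 1ℚ r (≤-trans (+-monoˡ-≤ (- 1ℚ) 0≤r+1)
                              (≤-reflexive (trans (cong (_- 1ℚ) (+-comm r 1ℚ)) (ring13 1ℚ r)))) ⟩
      1ℚ                 ≤⟨ 1≤ι (ℕ.≤-trans 1≤J (ℕ.m≤n*m J D)) ⟩
      ι (D ℕ.* J)        ∎
    by-sign (inj₁ ∣r∣≡r) = ≮⇒≥ λ DJ<∣r∣ → <⇒≱ (begin-strict
      l + 1ℚ                       <⟨ +-monoˡ-< 1ℚ l< ⟩
      ι T + 1ℚ                     ≡⟨ trans (+-comm (ι T) 1ℚ) (sym (ι-suc T)) ⟩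
      ι (suc T)                    ≤⟨ ι-mono square ⟩
      ι (D ℕ.* J ℕ.* (D ℕ.* J))    ≡⟨ ι-* (D ℕ.* J) (D ℕ.* J) ⟩
      ι (D ℕ.* J) * ι (D ℕ.* J)    ≤⟨ *-mono (ι-nonNeg (D ℕ.* J)) (0≤∣p∣ r) (<⇒≤ DJ<∣r∣) (<⇒≤ DJ<∣r∣) ⟩
      ∣ r ∣ * ∣ r ∣                ≡⟨ cong₂ _*_ ∣r∣≡r ∣r∣≡r ⟩
      r * r                        ∎) rr≤

  -- The exponent - c r with c = q / (d + 1) is cut into J = j + 1 equal parts u. The bound on r
  -- makes each part at most q in absolute value, as `exp-lower` demands.
  scaled-step : ∀ {q} → 0ℚ < q → ∀ d j r → ∣ r ∣ ≤ ι (suc d ℕ.* suc j) →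
    ∃ λ u → ∣ u ∣ ≤ q × ι (suc j) * u ≡ - (q * recip d * r)
  scaled-step {q} q>0 d j r r≤ = u , u≤q , ιJ*u
    where
    open ≤-Reasoning
    c u : ℚ
    c = q * recip d
    c>0 : 0ℚ < c
    c>0 = *-pos q>0 (recip-pos d)
    u = - (c * r) * recip j
    ιJ*u : ι (suc j) * u ≡ - (c * r)
    ιJ*u = trans (ring21 (ι (suc j)) (- (c * r)) (recip j))
      (trans (cong (- (c * r) *_) (ι*recip j)) (*-identityʳ (- (c * r))))
    u≤q : ∣ u ∣ ≤ q
    u≤q = begin
      ∣ u ∣                              ≡⟨ ∣p*q∣≡∣p∣*∣q∣ (- (c * r)) (recip j) ⟩
      ∣ - (c * r) ∣ * ∣ recip j ∣        ≡⟨ cong₂ _*_ (trans (∣-p∣≡∣p∣ (c * r)) (∣p*q∣≡∣p∣*∣q∣ c r)) (0≤p⇒∣p∣≡p (recip-nonNeg j)) ⟩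
      ∣ c ∣ * ∣ r ∣ * recip j            ≡⟨ cong (λ z → z * ∣ r ∣ * recip j) (0≤p⇒∣p∣≡p (<⇒≤ c>0)) ⟩
      c * ∣ r ∣ * recip j                ≤⟨ *-monoʳ (recip-nonNeg j) (*-monoˡ (<⇒≤ c>0) r≤) ⟩
      c * ι (suc d ℕ.* suc j) * recip j  ≡⟨ cong (λ z → c * z * recip j) (ι-* (suc d) (suc j)) ⟩
      q * recip d * (ι (suc d) * ι (suc j)) * recip j
                                         ≡⟨ ring19 q (recip d) (ι (suc d)) (ι (suc j)) (recip j) ⟩
      q * (ι (suc d) * recip d) * (ι (suc j) * recip j)
                                         ≡⟨ cong₂ (λ y z → q * y * z) (ι*recip d) (ι*recip j) ⟩
      q * 1ℚ * 1ℚ                        ≡⟨ trans (*-identityʳ (q * 1ℚ)) (*-identityʳ q) ⟩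
      q                                  ∎

  module MainBound (e : ℕ) (1≤e : 1 ℕ.≤ e) where

    open CountBound e 1≤e public using (g; threshold)
    open CountBound e 1≤e using (A; V; K₂; count-bound)
    open ≤-Reasoning
    -- The argument is V - 1, so that ρ = V / (V + 1) = 1 - 1/(2 g^2).
    open Ratio (4 ℕ.* e ℕ.+ 2 ℕ.* (e ℕ.* e))

    K₃ C d : ℕ
    K₃ = 2 ℕ.* K₂
    C  = K₃ ℕ.+ K₃
    d  = g ℕ.* A

    lower : ∃ λ q → 0ℚ < q ×
      (∀ k → ∃ λ N → ∀ n → N ℕ.≤ n → ∀ {u} → ∣ u ∣ ≤ q → pow ρ k ≤ expSum (ι k * u) n)
    lower = exp-lower ρ>0 (½-pos (recip-pos V)) ρ+2δ≡1

    q c : ℚ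
    q = proj₁ lower
    c = q * recip d

    q>0 : 0ℚ < q
    q>0 = proj₁ (proj₂ lower)

    c>0 : 0ℚ < c
    c>0 = *-pos q>0 (recip-pos d)

    0<c : 0ᴿ <ᴿ fromℚ c
    0<c = c , c>0 , 0 , λ _ _ → ≤-reflexive (+-identityˡ c)

    bound : (g≥2 : 2 ℕ.≤ g) (a₀ : Digit g) → 1 ℕ.≤ toℕ a₀ →
      (x : ℝ) → fromℕ (threshold 0) ≤ᴿ x →
      (N : ℕ) → N IsFloorOf x →
      (logx : ℝ) → logx IsLogOf x →
      (√logx : ℝ) → √logx IsSqrtOf logx →
      fromℕ (count (compositeMissing? g g≥2 a₀) N) ≤ᴿ fromℕ C *ᴿ (x *ᴿ exp (-ᴿ (fromℚ c *ᴿ √logx)))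
    bound g≥2 a₀ 1≤a₀ x x₀≤x N (N≤x , ε₁ , ε₁>0 , M₁ , x<N+1) logx (exp≤x , _) √logx (√≥0 , √²≤ , _) ε ε>0 =
      n₀ , λ n n₀≤n → estimate n n₀≤n
      where
      -- The gap ε₁ between x and N + 1 is halved: one half pays for the error in comparing x with
      -- x₀ or with exp (log x), the other keeps the inequality strict.
      ε₁/2>0 : 0ℚ < ε₁ * ½
      ε₁/2>0 = ½-pos ε₁>0

      x<N+1′ : ∀ n → M₁ ℕ.≤ n → seq x n + ε₁ * ½ < ι (suc N)
      x<N+1′ n M₁≤n = <-≤-trans (+-monoʳ-< (seq x n) (subst₂ _<_ (+-identityʳ (ε₁ * ½)) (halves ε₁)
        (+-monoʳ-< (ε₁ * ½) ε₁/2>0))) (x<N+1 n M₁≤n)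

      threshold≤N : threshold 0 ℕ.≤ N
      threshold≤N = ℕ.s≤s⁻¹ (ι-cancel-< (≤-<-trans (proj₂ (x₀≤x (ε₁ * ½) ε₁/2>0) (M ℕ.+ M₁) (ℕ.m≤m+n M M₁))
                                                     (x<N+1′ (M ℕ.+ M₁) (ℕ.m≤n+m M₁ M))))
        where
        M : ℕ
        M = proj₁ (x₀≤x (ε₁ * ½) ε₁/2>0)

      counted : ∃ λ k → N ℕ.< threshold (suc k) ×
        count (compositeMissing? g g≥2 a₀) N ℕ.* suc V ℕ.^ suc k ℕ.≤ K₂ ℕ.* N ℕ.* V ℕ.^ suc k
      counted = count-bound g≥2 a₀ 1≤a₀ N threshold≤N

      k J E : ℕ
      k = proj₁ counted
      J = suc (suc k)
      E = A ℕ.* (J ℕ.* J)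

      M₂ M₃ M₄ M₅ M₆ n₀ : ℕ
      M₂ = proj₁ (exp≤x (ε₁ * ½) ε₁/2>0)
      M₃ = proj₁ (√²≤ 1ℚ 0<1)
      M₄ = proj₁ (√≥0 1ℚ 0<1)
      M₅ = proj₁ (N≤x ½ (½-pos 0<1))
      M₆ = proj₁ (proj₂ (proj₂ lower) J)
      -- The last summand `suc E` makes the partial sum at stage n contain the term of index E.
      n₀ = M₁ ℕ.+ (M₂ ℕ.+ (M₃ ℕ.+ (M₄ ℕ.+ (M₅ ℕ.+ (M₆ ℕ.+ suc E)))))

      module _ (n : ℕ) (n₀≤n : n₀ ℕ.≤ n) where
        n₁ = ℕ.m+n≤o⇒n≤o M₁ n₀≤n
        n₂ = ℕ.m+n≤o⇒n≤o M₂ n₁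
        n₃ = ℕ.m+n≤o⇒n≤o M₃ n₂
        n₄ = ℕ.m+n≤o⇒n≤o M₄ n₃
        n₅ = ℕ.m+n≤o⇒n≤o M₅ n₄
        n₆ = ℕ.m+n≤o⇒n≤o M₆ n₅

        xₙ rₙ eₙ : ℚ
        xₙ = seq x n
        rₙ = seq √logx n
        eₙ = expSum (- (c * rₙ)) n

        log< : seq logx n < ι (g ℕ.* E)
        -- If log x were at least g E, the term of index E alone would make exp (log x) at least g^E
        -- ≥ N + 1.
        log< = ≰⇒> λ gE≤ → <⇒≱ (begin-strict
          expSum (seq logx n) n  ≤⟨ proj₂ (exp≤x (ε₁ * ½) ε₁/2>0) n (ℕ.m+n≤o⇒m≤o M₂ n₁) ⟩
          xₙ + ε₁ * ½            <⟨ x<N+1′ n (ℕ.m+n≤o⇒m≤o M₁ n₀≤n) ⟩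
          ι (suc N)              ≤⟨ ι-mono (proj₁ (proj₂ counted)) ⟩
          ι (g ℕ.^ E)            ∎) (power≤expSum g E gE≤ n₆)

        √< : ∣ rₙ ∣ ≤ ι (suc d ℕ.* J)
        √< = sqrt-bound g A J rₙ log<
          (proj₂ (√²≤ 1ℚ 0<1) n (ℕ.m+n≤o⇒m≤o M₃ n₂)) (proj₂ (√≥0 1ℚ 0<1) n (ℕ.m+n≤o⇒m≤o M₄ n₃))

        pow≤ : pow ρ J ≤ eₙ
        pow≤ = subst (λ z → pow ρ J ≤ expSum z n) (proj₂ (proj₂ step))
          (proj₂ (proj₂ (proj₂ lower) J) n (ℕ.m+n≤o⇒m≤o M₆ n₅) (proj₁ (proj₂ step)))
          where
          step : ∃ λ u → ∣ u ∣ ≤ q × ι J * u ≡ - (c * rₙ)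
          step = scaled-step q>0 d (suc k) rₙ √<

        -- At stage n only N ≤ x + 1/2 is known. As N ≥ 1, doubling x swallows this error, and the
        -- final estimate stays multiplicative.
        N≤2x : ι N ≤ xₙ + xₙ
        N≤2x = +-cancelʳ-≤ 1ℚ (ι N) (xₙ + xₙ) (begin
          ι N + 1ℚ                 ≤⟨ +-monoʳ-≤ (ι N) (1≤ι (ℕ.≤-trans (ℕ.m^n>0 g (A ℕ.* 1)) threshold≤N)) ⟩
          ι N + ι N                ≤⟨ +-mono-≤ N≤ N≤ ⟩
          xₙ + ½ + (xₙ + ½)        ≡⟨ ring22 xₙ ⟩
          xₙ + xₙ + 1ℚ             ∎)
          where
          N≤ : ι N ≤ xₙ + ½
          N≤ = proj₂ (N≤x ½ (½-pos 0<1)) n (ℕ.m+n≤o⇒m≤o M₅ n₄)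

        estimate : ι (count (compositeMissing? g g≥2 a₀) N) ≤ ι C * (xₙ * eₙ) + ε
        estimate = begin
          ι (count (compositeMissing? g g≥2 a₀) N)
            ≤⟨ ι-ratio (count (compositeMissing? g g≥2 a₀) N) K₂ N (suc k) (proj₂ (proj₂ counted)) ⟩
          ι K₃ * (ι N * pow ρ J)
            ≤⟨ *-monoˡ (ι-nonNeg K₃) (*-mono (<⇒≤ (pow-pos ρ>0 J)) (≤-trans (ι-nonNeg N) N≤2x) N≤2x pow≤) ⟩
          ι K₃ * ((xₙ + xₙ) * eₙ)     ≡⟨ ring20 (ι K₃) xₙ eₙ ⟩
          (ι K₃ + ι K₃) * (xₙ * eₙ)   ≡⟨ cong (_* (xₙ * eₙ)) (ι-+ K₃ K₃) ⟨
          ι C * (xₙ * eₙ)             ≡⟨ +-identityʳ _ ⟨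
          ι C * (xₙ * eₙ) + 0ℚ        ≤⟨ +-monoʳ-≤ (ι C * (xₙ * eₙ)) (<⇒≤ ε>0) ⟩
          ι C * (xₙ * eₙ) + ε         ∎

open import Data.Nat using (ℕ; _≤_; suc; s≤s)

theorem1p5 : (g : ℕ) (g≥2 : 2 ≤ g) →
    Σ[ c ∈ ℝ ] 0ᴿ <ᴿ c ×
    (Σ[ C ∈ ℝ ] Σ[ x₀ ∈ ℝ ]
    ((a₀ : Digit g) → 1 ≤ toℕ a₀ →
    (x : ℝ) → x₀ ≤ᴿ x →
    (N : ℕ) → N IsFloorOf x →
    (logx : ℝ) → logx IsLogOf x →
    (√logx : ℝ) → √logx IsSqrtOf logx →
    fromℕ (count (compositeMissing? g g≥2 a₀) N) ≤ᴿ C *ᴿ (x *ᴿ exp (-ᴿ (c *ᴿ √logx)))))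
theorem1p5 (suc e) g≥2@(s≤s 1≤e) =
  fromℚ c , 0<c , fromℕ C , fromℕ (threshold 0) , bound g≥2
  where open Analysis.MainBound e 1≤e
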